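{- Let $s\geq 3$ be an odd integer. Then (i) if $m\geq 2$ is even and $n\geq \frac{sm}{2}(sm-2)$, then $R(P_n,J_{s,m})=2n-1$; (ii) if $m\geq 3$ is odd and $n\geq \frac{sm-1}{2}(sm-1)$, then $R(P_n,J_{s,m})=2n$.
   Context: All graphs are finite and simple. For graphs $G$ and $H$, the Ramsey number $R(G,H)$ is the least natural number $N$ such that for every graph $F$ on $N$ vertices, either $F$ contains $G$ as a subgraph or the complement $\overline{F}$ contains $H$ as a subgraph. $P_n$ denotes the path on $n$ vertices. For integers $s,m\geq 2$, the generalized Jahangir graph $J_{s,m}$ is the graph on $sm+1$ vertices consisting of a cycle $C_{sm}=v_1v_2\cdots v_{sm}v_1$ together with one additional vertex adjacent to exactly the $m$ cycle vertices $v_1, v_{s+1}, v_{2s+1},\ldots,v_{(m-1)s+1}$ (i.e., $m$ vertices of the cycle at distance $s$ from each other along the cycle). -}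

module Defs where

open import Data.Empty using (⊥)
open import Data.Fin using (Fin; zero; suc; toℕ)
import Data.Fin.Properties as Fin
open import Data.Nat using (ℕ; suc; _*_; _≤_; _≟_)
open import Data.Nat.Divisibility using (_∣_; _∣?_)
open import Data.Product using (Σ-syntax; _×_; _,_)
open import Data.Sum using (_⊎_; swap)
open import Function.Definitions using (Injective)
open import Level using (0ℓ)
open import Relation.Binary.Core using (Rel)
open import Relation.Binary.Definitions using (Decidable; Irreflexive; Symmetric)
open import Relation.Binary.PropositionalEquality using (_≡_; _≢_; refl; ≢-sym)
open import Relation.Nullary using (¬_; no)
open import Relation.Nullary.Decidable using (¬?; _×-dec_; _⊎-dec_)

-- Decidability of adjacency is part of the structure: classically it is no
-- restriction, and it is what makes the Ramsey property below meaningful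
-- constructively.
record Graph (n : ℕ) : Set₁ where
  field
    Adj    : Rel (Fin n) 0ℓ
    adj?   : Decidable Adj
    sym    : Symmetric Adj
    irrefl : Irreflexive _≡_ Adj

open Graph public using (Adj)

complement : ∀ {n} → Graph n → Graph n
complement G = record
  { Adj    = λ u v → u ≢ v × ¬ Adj G u v
  ; adj?   = λ u v → ¬? (u Fin.≟ v) ×-dec ¬? (Graph.adj? G u v)
  ; sym    = λ (u≢v , ¬uv) → ≢-sym u≢v , λ vu → ¬uv (Graph.sym G vu)
  ; irrefl = λ u≡v (u≢v , _) → u≢v u≡v
  }

-- Not necessarily induced.
_IsSubgraphOf_ : ∀ {m n} → Graph m → Graph n → Set
_IsSubgraphOf_ {m} {n} G F =
  Σ[ f ∈ (Fin m → Fin n) ]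
    Injective _≡_ _≡_ f × (∀ {u v} → Adj G u v → Adj F (f u) (f v))

RamseyProperty : ∀ {a b} → Graph a → Graph b → ℕ → Set₁
RamseyProperty G H N =
  (F : Graph N) → G IsSubgraphOf F ⊎ H IsSubgraphOf complement F

-- R(G , H) = N
IsRamseyNumber : ∀ {a b} → Graph a → Graph b → ℕ → Set₁
IsRamseyNumber G H N =
  RamseyProperty G H N × (∀ M → RamseyProperty G H M → N ≤ M)

fromRelation : ∀ {n} (R : Rel (Fin n) 0ℓ) → Decidable R → Graph n
fromRelation R R? = record
  { Adj    = λ u v → u ≢ v × (R u v ⊎ R v u)
  ; adj?   = λ u v → ¬? (u Fin.≟ v) ×-dec (R? u v ⊎-dec R? v u)
  ; sym    = λ (u≢v , r) → ≢-sym u≢v , swap r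
  ; irrefl = λ u≡v (u≢v , _) → u≢v u≡v
  }

path : ∀ n → Graph n
path n = fromRelation (λ i j → toℕ j ≡ suc (toℕ i))
                      (λ i j → toℕ j ≟ suc (toℕ i))

-- The usual cycle when k ≥ 3; for smaller k it degenerates to a complete graph.
cycle : ∀ k → Graph k
cycle k = fromRelation
  (λ i j → toℕ j ≡ suc (toℕ i) ⊎ (suc (toℕ i) ≡ k × toℕ j ≡ 0))
  (λ i j → (toℕ j ≟ suc (toℕ i)) ⊎-dec ((suc (toℕ i) ≟ k) ×-dec (toℕ j ≟ 0)))

-- Vertex zero is the additional vertex, and vertex suc i is the cycle vertex
-- v₍ᵢ₊₁₎; thus v₁, v₍ₛ₊₁₎, …, v₍₍ₘ₋₁₎ₛ₊₁₎ are those with i a multiple of s.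
module _ (s m : ℕ) where

  JahangirAdj : Rel (Fin (suc (s * m))) 0ℓ
  JahangirAdj zero    zero    = ⊥
  JahangirAdj zero    (suc j) = s ∣ toℕ j
  JahangirAdj (suc i) zero    = s ∣ toℕ i
  JahangirAdj (suc i) (suc j) = Adj (cycle (s * m)) i j

  jahangir : Graph (suc (s * m))
  jahangir = record
    { Adj    = JahangirAdj
    ; adj?   = dec
    ; sym    = λ {u} {v} → symm u v
    ; irrefl = λ {u} {v} → irr u v
    }
    where
    dec : Decidable JahangirAdj
    dec zero    zero    = no λ ()
    dec zero    (suc j) = s ∣? toℕ j
    dec (suc i) zero    = s ∣? toℕ i
    dec (suc i) (suc j) = Graph.adj? (cycle (s * m)) i j

    symm : ∀ u v → JahangirAdj u v → JahangirAdj v u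
    symm zero    (suc j) p = p
    symm (suc i) zero    p = p
    symm (suc i) (suc j) p = Graph.sym (cycle (s * m)) p

    irr : ∀ u v → u ≡ v → ¬ JahangirAdj u v
    irr (suc i) .(suc i) refl p = Graph.irrefl (cycle (s * m)) refl p

{-# OPTIONS --safe #-}
module Submission where

-- Lower bound: take two disjoint cliques on n − 1 vertices, and for odd m also
-- an isolated vertex. A copy of J_{s,m} in the complement would be bipartite,
-- respectively bipartite up to one vertex. But the hub and the arc of the rim
-- between two consecutive spokes form an odd cycle since s is odd, and for odd
-- m no vertex meets all the odd cycles.
--
-- Upper bound: depth-first search yields a path on n vertices or two large
-- equal sets A, B with no edge between them. If too many vertices of A have many
-- non-neighbours in A, one of them is the hub of a J_{s,m} in the complement
-- whose rim alternates between A and B. Otherwise A, and likewise B, is almost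
-- a clique, hence has Hamiltonian paths starting at any vertex (insert the
-- vertices one by one). So a vertex adjacent to both sides gives a path on n
-- vertices; if there is none, all vertices are distributed over A and B. One
-- part is then so large that it has a path on n vertices, except that for odd m
-- each part may be an almost clique on n − 1 vertices and one exceptional vertex;
-- these four pieces give a path on n vertices or a complete tripartite graph in
-- the complement that contains J_{s,m}.

open import Defs
open import Data.Empty using (⊥; ⊥-elim)
open import Data.Fin using (Fin; zero; suc; toℕ; fromℕ<; cast)
import Data.Fin.Properties as Fin
open import Data.List
  using (List; []; _∷_; [_]; _++_; _ʳ++_; length; lookup; filter; allFin)
open import Data.List.Membership.Propositional using (_∈_; _∉_; find; lose)
open import Data.List.Membership.Propositional.Properties
  using (∈-∃++; ∈-filter⁺; ∈-filter⁻; ∈-++⁺ˡ; ∈-++⁺ʳ; ∈-++⁻; ∈-lookup; ∈-allFin)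
open import Data.List.Properties
  using (length-++; length-tabulate; filter-++;
         filter-accept; filter-reject; filter-some; ++-identityʳ)
open import Data.List.Relation.Binary.Disjoint.Propositional using (Disjoint)
open import Data.List.Relation.Binary.Permutation.Propositional
  using (_↭_; ↭-refl; ↭-sym; ↭-trans; ↭-prep; ↭-swap; ↭⇒↭ₛ)
open import Data.List.Relation.Binary.Permutation.Propositional.Properties
  using (∈-resp-↭; ↭-length; filter-↭; shift; ++↭ʳ++)
  renaming (++⁺ʳ to ↭-++⁺ʳ; ++⁺ˡ to ↭-++⁺ˡ; ++-comm to ↭-++-comm)
import Data.List.Relation.Binary.Permutation.Setoid.Properties as ↭ₛ
import Data.List.Relation.Binary.Sublist.Propositional.Properties as Sub
open import Data.List.Relation.Unary.All as All using (All; []; _∷_)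
open import Data.List.Relation.Unary.All.Properties
  using (¬Any⇒All¬; ++⁻ˡ; ++⁻ʳ)
open import Data.List.Relation.Unary.AllPairs using ([]; _∷_)
open import Data.List.Relation.Unary.Any using (any?; here; there)
open import Data.List.Relation.Unary.Linked using (Linked; []; [-]; _∷_; tail)
open import Data.List.Relation.Unary.Unique.Propositional using (Unique)
import Data.List.Relation.Unary.Unique.Propositional.Properties as Uniq
open import Data.Nat
open import Data.Nat.Divisibility
open import Data.Nat.DivMod
open import Data.Nat.Properties
open import Data.Nat.Tactic.RingSolver using (solve-∀)
open import Data.Product using (∃; ∃₂; _×_; _,_; proj₁; proj₂)
open import Data.Sum using (_⊎_; inj₁; inj₂; [_,_]′)
open import Function using (_∘_; id)
open import Function.Definitions using (Injective)
open import Relation.Binary.PropositionalEquality hiding ([_])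
open import Relation.Nullary using (¬_; Dec; yes; no; contradiction)
open import Relation.Nullary.Decidable using (¬?; map′; _×-dec_)
open import Relation.Unary using (Decidable)

-- The certificate consists of a combination a ≤ b of the hypotheses and a slack.
≤-certificate : ∀ {a b} x y slack → a ≤ b → x + b + slack ≡ y + a → x ≤ y
≤-certificate {a} {b} x y slack a≤b eq = +-cancelʳ-≤ b x y (begin
  x + b          ≤⟨ m≤m+n (x + b) slack ⟩
  x + b + slack  ≡⟨ eq ⟩
  y + a          ≤⟨ +-monoʳ-≤ y a≤b ⟩
  y + b          ∎)
  where open ≤-Reasoning

-- Lists: permutations, lists without repetition, and linked lists.

module _ {A : Set} where

  Unique-resp-↭ : {xs ys : List A} → xs ↭ ys → Unique xs → Unique ys
  Unique-resp-↭ p = ↭ₛ.Unique-resp-↭ (setoid A) (↭⇒↭ₛ p)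

  Unique-++⁻ : ∀ xs {ys : List A} → Unique (xs ++ ys) →
               Unique xs × Unique ys × Disjoint xs ys
  Unique-++⁻ []       u = [] , u , λ ()
  Unique-++⁻ (x ∷ xs) (x∉ ∷ u) with Unique-++⁻ xs u
  ... | uxs , uys , disj = ++⁻ˡ xs x∉ ∷ uxs , uys , λ where
    (here refl , v∈ys) → All.lookup (++⁻ʳ xs x∉) v∈ys refl
    (there v∈xs , v∈ys) → disj (v∈xs , v∈ys)

  Unique-∷ : ∀ {x} {xs : List A} → x ∉ xs → Unique xs → Unique (x ∷ xs)
  Unique-∷ {xs = xs} x∉ u = ¬Any⇒All¬ xs x∉ ∷ u

  lookup-injective : {xs : List A} → Unique xs → ∀ {i j} →
                     lookup xs i ≡ lookup xs j → i ≡ j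
  lookup-injective {_ ∷ xs} u {zero} {zero} eq = refl
  lookup-injective {_ ∷ xs} (x∉ ∷ u) {zero} {suc j} eq =
    contradiction eq (All.lookup x∉ (∈-lookup j))
  lookup-injective {_ ∷ xs} (x∉ ∷ u) {suc i} {zero} eq =
    contradiction (sym eq) (All.lookup x∉ (∈-lookup i))
  lookup-injective {_ ∷ xs} (x∉ ∷ u) {suc i} {suc j} eq =
    cong suc (lookup-injective u eq)

  lookup-consecutive : ∀ {R : A → A → Set} {xs} → Linked R xs →
                       ∀ i j → toℕ j ≡ suc (toℕ i) → R (lookup xs i) (lookup xs j)
  lookup-consecutive (r ∷ rs) zero    (suc zero) _  = r
  lookup-consecutive (r ∷ rs) (suc i) (suc j)    eq =
    lookup-consecutive rs i j (suc-injective eq)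

  lookup-last : ∀ {R : A → A → Set} xs {y} → Linked R (xs ++ [ y ]) →
                ∀ i → suc (toℕ i) ≡ length xs → R (lookup xs i) y
  lookup-last (x ∷ [])     (r ∷ _)  zero    _  = r
  lookup-last (x ∷ y ∷ xs) (_ ∷ rs) (suc i) eq =
    lookup-last (y ∷ xs) rs i (suc-injective eq)

  Linked-++⁻ˡ : ∀ {R : A → A → Set} xs {ys} → Linked R (xs ++ ys) → Linked R xs
  Linked-++⁻ˡ []           _        = []
  Linked-++⁻ˡ (x ∷ [])     _        = [-]
  Linked-++⁻ˡ (x ∷ y ∷ xs) (r ∷ rs) = r ∷ Linked-++⁻ˡ (y ∷ xs) rs

  filter-mono : ∀ {P Q : A → Set} (P? : Decidable P) (Q? : Decidable Q) xs →
                length (filter P? (filter Q? xs)) ≤ length (filter P? xs)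
  filter-mono P? Q? xs = Sub.length-mono-≤
    (Sub.filter⁺ P? P? (λ { refl p → p }) (Sub.filter-⊆ Q? xs))

  length-filter-¬ : ∀ {P : A → Set} (P? : Decidable P) xs →
                    length (filter P? xs) + length (filter (¬? ∘ P?) xs) ≡ length xs
  length-filter-¬ P? []       = refl
  length-filter-¬ P? (x ∷ xs) with P? x
  ... | yes _ = cong suc (length-filter-¬ P? xs)
  ... | no  _ = trans (+-suc _ _) (cong suc (length-filter-¬ P? xs))

  Unique-⊆⇒length≤ : ∀ {xs ys : List A} → Unique xs → (∀ {x} → x ∈ xs → x ∈ ys) →
                     length xs ≤ length ys
  Unique-⊆⇒length≤ {[]}     _ _ = z≤n
  Unique-⊆⇒length≤ {x ∷ xs} (x∉ ∷ u) ⊆ys with ∈-∃++ (⊆ys (here refl))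
  ... | as , bs , refl = subst (suc (length xs) ≤_) (sym (↭-length (shift x as bs)))
    (s≤s (Unique-⊆⇒length≤ u λ {y} y∈xs → strip y∈xs (∈-resp-↭ (shift x as bs) (⊆ys (there y∈xs)))))
    where
    strip : ∀ {y} → y ∈ xs → y ∈ x ∷ as ++ bs → y ∈ as ++ bs
    strip y∈xs (here refl) = contradiction refl (All.lookup x∉ y∈xs)
    strip y∈xs (there y∈)  = y∈

module _ {N : ℕ} where

  open import Data.List.Membership.DecPropositional (Fin._≟_ {N}) using (_∉?_; _∈?_)

  infixl 6 _∖_
  _∖_ : List (Fin N) → List (Fin N) → List (Fin N)
  xs ∖ ys = filter (_∉? ys) xs

  ∈-∖⁻ : ∀ {xs ys x} → x ∈ xs ∖ ys → x ∈ xs × x ∉ ys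
  ∈-∖⁻ {xs} {ys} = ∈-filter⁻ (_∉? ys) {xs = xs}

  length-∖ : ∀ {xs} ys → Unique xs → length xs ≤ length (xs ∖ ys) + length ys
  length-∖ {xs} ys u = begin
    length xs                        ≡⟨ length-filter-¬ (_∉? ys) xs ⟨
    length (xs ∖ ys) + length both   ≤⟨ +-monoʳ-≤ _ (Unique-⊆⇒length≤ (Uniq.filter⁺ _ u) both⊆ys) ⟩
    length (xs ∖ ys) + length ys     ∎
    where
    open ≤-Reasoning
    both = filter (¬? ∘ (_∉? ys)) xs
    both⊆ys : ∀ {x} → x ∈ both → x ∈ ys
    both⊆ys {x} x∈ with x ∈? ys
    ... | yes x∈ys = x∈ys
    ... | no  x∉ys = contradiction x∉ys (proj₂ (∈-filter⁻ (¬? ∘ (_∉? ys)) {xs = xs} x∈))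

-- Vertex lists in a graph: apartness and non-neighbours.

module InGraph {N : ℕ} (F : Graph N) where

  open import Data.List.Membership.DecPropositional (Fin._≟_ {N}) using (_∈?_)

  V : Set
  V = Fin N

  infix 4 _~_ _~?_
  _~_ : V → V → Set
  _~_ = Adj F

  _~?_ : ∀ x y → Dec (x ~ y)
  _~?_ = Graph.adj? F

  ~-sym : ∀ {x y} → x ~ y → y ~ x
  ~-sym = Graph.sym F

  ~-irrefl : ∀ {x} → ¬ x ~ x
  ~-irrefl = Graph.irrefl F refl

  Apart : List V → List V → Set
  Apart C D = ∀ {x y} → x ∈ C → y ∈ D → ¬ x ~ y

  Apart-sym : ∀ {C D} → Apart C D → Apart D C
  Apart-sym ap x∈D y∈C x~y = ap y∈C x∈D (~-sym x~y)

  nonNbrs : V → List V → List V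
  nonNbrs z = filter (λ y → ¬? (z ~? y))

  -- A vertex of C is counted among its own non-neighbours in C.
  nonDeg : V → List V → ℕ
  nonDeg z C = length (nonNbrs z C)

  ∈-nonNbrs⁻ : ∀ {z C y} → y ∈ nonNbrs z C → y ∈ C × ¬ z ~ y
  ∈-nonNbrs⁻ {z} {C} = ∈-filter⁻ (λ y → ¬? (z ~? y)) {xs = C}

  nonDeg-∷-adj : ∀ {z y} C → z ~ y → nonDeg z (y ∷ C) ≡ nonDeg z C
  nonDeg-∷-adj {z} C zy =
    cong length (filter-reject (λ y → ¬? (z ~? y)) {xs = C} (λ ¬zy → ¬zy zy))

  nonDeg-∷-non : ∀ {z y} C → ¬ z ~ y → nonDeg z (y ∷ C) ≡ suc (nonDeg z C)
  nonDeg-∷-non {z} C ¬zy =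
    cong length (filter-accept (λ y → ¬? (z ~? y)) {xs = C} ¬zy)

  nonDeg-++ : ∀ z C D → nonDeg z (C ++ D) ≡ nonDeg z C + nonDeg z D
  nonDeg-++ z C D = trans (cong length (filter-++ _ C D)) (length-++ (nonNbrs z C))

  nonDeg-↭ : ∀ z {C D} → C ↭ D → nonDeg z C ≡ nonDeg z D
  nonDeg-↭ z p = ↭-length (filter-↭ _ p)

  nonDeg-isolated : ∀ z C → (∀ {y} → y ∈ C → ¬ z ~ y) → nonDeg z C ≡ length C
  nonDeg-isolated z []      iso = refl
  nonDeg-isolated z (y ∷ C) iso =
    trans (nonDeg-∷-non C (iso (here refl))) (cong suc (nonDeg-isolated z C (iso ∘ there)))

  nonDeg-∈ : ∀ {z C} → z ∈ C → 1 ≤ nonDeg z C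
  nonDeg-∈ z∈C = filter-some _ (lose z∈C ~-irrefl)

  -- Hamiltonian paths in near-cliques.

  NearClique : ℕ → List V → Set
  NearClique q C = ∀ {z} → z ∈ C → nonDeg z C ≤ q

  -- The end `v` stays fixed while the end `x` grows. Nothing is ever placed beyond `v`, so the
  -- finished walk, reversed, is a path with a prescribed start.
  data Walk (v : V) : V → List V → Set where
    done : Walk v v []
    step : ∀ {x y l} → x ~ y → Walk v y l → Walk v x (y ∷ l)

  Linked-ʳ++ : ∀ {x l acc} → Linked _~_ (x ∷ l) → Linked _~_ (x ∷ acc) →
               Linked _~_ (l ʳ++ (x ∷ acc))
  Linked-ʳ++ [-]       acc = acc
  Linked-ʳ++ (xy ∷ yl) acc = Linked-ʳ++ yl (~-sym xy ∷ acc)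

  reverseWalk : ∀ {v x l} acc → Walk v x l → Linked _~_ (x ∷ acc) →
                ∃ λ M → Linked _~_ (v ∷ M) × v ∷ M ↭ x ∷ l ++ acc
  reverseWalk acc done link = acc , link , ↭-refl
  reverseWalk {x = x} {l = y ∷ l} acc (step xy w) link
    with reverseWalk (x ∷ acc) w (~-sym xy ∷ link)
  ... | M , link′ , p = M , link′ , ↭-trans p (shift x (y ∷ l) acc)

  -- If no two consecutive vertices are both neighbours of `w`, the neighbours outnumber the
  -- non-neighbours by at most one, and not at all if the walk starts with a non-neighbour. This is
  -- the difference between the last two bounds.
  data Insertion (w v x : V) (l : List V) : Set where
    inserted : ∀ l′ → Walk v x l′ → l′ ↭ w ∷ l → Insertion w v x l
    adjacent : w ~ x → length (x ∷ l) ≤ suc (2 * nonDeg w (x ∷ l)) → Insertion w v x l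
    blocked  : ¬ w ~ x → length (x ∷ l) ≤ 2 * nonDeg w (x ∷ l) → Insertion w v x l

  -- If w fits between no two consecutive vertices of the walk, then each
  -- consecutive pair contains a non-neighbour of w.
  insert : ∀ w {v x l} → Walk v x l → Insertion w v x l
  insert w {v} done with w ~? v
  ... | yes wv = adjacent wv (s≤s z≤n)
  ... | no ¬wv =
    blocked ¬wv (subst (λ d → 1 ≤ 2 * d) (sym (nonDeg-∷-non [] ¬wv)) (s≤s z≤n))
  insert w {v} {x} {y ∷ l} (step xy walk) with insert w walk
  ... | inserted l′ walk′ p = inserted (y ∷ l′) (step xy walk′)
    (↭-trans (↭-prep y p) (↭-swap y w ↭-refl))
  ... | adjacent wy le with w ~? x
  ...   | yes wx = inserted (w ∷ y ∷ l) (step (~-sym wx) (step wy walk)) ↭-refl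
  ...   | no ¬wx = blocked ¬wx (subst (λ d → suc (length (y ∷ l)) ≤ 2 * d)
    (sym (nonDeg-∷-non (y ∷ l) ¬wx)) (arith le))
    where
    arith : ∀ {m d} → m ≤ suc (2 * d) → suc m ≤ 2 * suc d
    ident : ∀ m d → suc m + suc (2 * d) + 0 ≡ 2 * suc d + m
    ident = solve-∀
    arith {m} {d} le = ≤-certificate (suc m) (2 * suc d) 0 le (ident m d)
  insert w {v} {x} {y ∷ l} (step xy walk) | blocked ¬wy le with w ~? x
  ...   | yes wx = adjacent wx (subst (λ d → suc (length (y ∷ l)) ≤ suc (2 * d))
    (sym (nonDeg-∷-adj (y ∷ l) wx)) (s≤s le))
  ...   | no ¬wx = blocked ¬wx (subst (λ d → suc (length (y ∷ l)) ≤ 2 * d)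
    (sym (nonDeg-∷-non (y ∷ l) ¬wx)) (arith le))
    where
    arith : ∀ {m d} → m ≤ 2 * d → suc m ≤ 2 * suc d
    ident : ∀ m d → suc m + 2 * d + 1 ≡ 2 * suc d + m
    ident = solve-∀
    arith {m} {d} le = ≤-certificate (suc m) (2 * suc d) 1 le (ident m d)

  -- The walk absorbs `w`, or else a remaining vertex adjacent to its front `x`. If neither is
  -- possible, `x` has itself and all remaining vertices as non-neighbours, so at most `q - 1`
  -- vertices remain. Also `w` has at most `q - 1` non-neighbours on the walk, which thus has at
  -- most `2 * (q - 1)` vertices. Then `C` has at most `3 * q - 3` vertices, a contradiction.
  growWalk : ∀ {q C} → NearClique q C → 3 * q ≤ length C + 2 →
             ∀ m {v x l} W → length W ≡ m → Walk v x l → x ∷ l ++ W ↭ C →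
             ∃ λ M → Linked _~_ (v ∷ M) × v ∷ M ↭ C
  growWalk near big zero [] eq walk p with reverseWalk [] walk [-]
  ... | M , link , p′ = M , link , ↭-trans p′ p
  growWalk {q} {C} near big (suc m) {v} {x} {l} (w ∷ W) eq walk p with insert w walk
  ... | inserted l′ walk′ p′ = growWalk near big m W (suc-injective eq) walk′
    (↭-trans (↭-prep x (↭-trans (↭-++⁺ʳ W p′) (↭-sym (shift w l W)))) p)
  ... | adjacent wx _ = growWalk near big m W (suc-injective eq) (step wx walk)
    (↭-trans (↭-sym (shift w (x ∷ l) W)) p)
  ... | blocked ¬wx le with any? (x ~?_) (w ∷ W)
  ...   | yes found with find found
  ...     | y , y∈ , xy with ∈-∃++ y∈
  ...       | as , bs , eq′ = growWalk near big m (as ++ bs)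
    (suc-injective (trans (sym (trans (cong length eq′) (↭-length (shift y as bs)))) eq))
    (step (~-sym xy) walk)
    (↭-trans (↭-trans (↭-sym (shift y (x ∷ l) (as ++ bs)))
                      (↭-++⁺ˡ (x ∷ l) (↭-sym (shift y as bs))))
             (subst (λ W′ → x ∷ l ++ W′ ↭ C) eq′ p))
  growWalk {q} {C} near big (suc m) {v} {x} {l} (w ∷ W) eq walk p | blocked ¬wx le | no none =
    ⊥-elim (arith (length (x ∷ l)) (length (w ∷ W)) (nonDeg w (x ∷ l)) le x-count w-count
      (subst (λ t → 3 * q ≤ t + 2)
        (trans (sym (↭-length p)) (length-++ (x ∷ l))) big))
    where
    open ≤-Reasoning
    x-count : suc (length (w ∷ W)) ≤ q
    x-count = begin
      1 + length (w ∷ W)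
        ≤⟨ +-mono-≤ (nonDeg-∈ {x} {x ∷ l} (here refl))
             (≤-reflexive (sym (nonDeg-isolated x (w ∷ W) (λ y∈ xy → none (lose y∈ xy))))) ⟩
      nonDeg x (x ∷ l) + nonDeg x (w ∷ W)   ≡⟨ nonDeg-++ x (x ∷ l) (w ∷ W) ⟨
      nonDeg x (x ∷ l ++ w ∷ W)             ≡⟨ nonDeg-↭ x p ⟩
      nonDeg x C                            ≤⟨ near (∈-resp-↭ p (here refl)) ⟩
      q                                     ∎
    w-count : nonDeg w (x ∷ l) + 1 ≤ q
    w-count = begin
      nonDeg w (x ∷ l) + 1                  ≤⟨ +-monoʳ-≤ _ (nonDeg-∈ {w} {w ∷ W} (here refl)) ⟩
      nonDeg w (x ∷ l) + nonDeg w (w ∷ W)   ≡⟨ nonDeg-++ w (x ∷ l) (w ∷ W) ⟨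
      nonDeg w (x ∷ l ++ w ∷ W)             ≡⟨ nonDeg-↭ w p ⟩
      nonDeg w C                            ≤⟨ near (∈-resp-↭ p (∈-++⁺ʳ (x ∷ l) (here refl))) ⟩
      q                                     ∎
    arith : ∀ a b c → a ≤ 2 * c → suc b ≤ q → c + 1 ≤ q → ¬ 3 * q ≤ a + b + 2
    ident : ∀ a b c q → 1 + (2 * c + q + 2 * q + (a + b + 2)) + 0 ≡ 0 + (a + suc b + 2 * (c + 1) + 3 * q)
    ident = solve-∀
    arith a b c h₁ h₂ h₃ h₄ = n≮n 0
      (≤-certificate 1 0 0 (+-mono-≤ (+-mono-≤ (+-mono-≤ h₁ h₂) (*-monoʳ-≤ 2 h₃)) h₄)
        (ident a b c q))

  hamiltonianPath : ∀ {q C v} → NearClique q C → 3 * q ≤ length C + 2 → v ∈ C →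
                    ∃ λ M → Linked _~_ (v ∷ M) × v ∷ M ↭ C
  hamiltonianPath {v = v} near big v∈C with ∈-∃++ v∈C
  ... | as , bs , refl =
    growWalk near big _ (as ++ bs) refl done (↭-sym (shift v as bs))

  -- Depth-first search for a long path or two equal apart sets.

  record Separation : Set where
    field
      left stack right : List V
      perm   : left ++ stack ++ right ↭ allFin N
      linked : Linked _~_ stack
      apart  : Apart left right
      balanced : length left ≡ length right

  -- Depth-first search: P is the stack, B the set of finished vertices.
  -- The difference |A| − |B| drops by one in each step.
  separate : Separation
  separate = search (length (allFin N) + length (allFin N) + 0) (allFin N) [] [] ≤-refl
    (subst (λ l → l ↭ allFin N) (sym (++-identityʳ (allFin N))) ↭-refl) [] (λ _ ()) z≤n
    where
    -- The fuel `m` bounds twice the size of `A` plus the size of `P`. This drops by one whenever a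
    -- vertex moves from `A` to the stack or from the stack to `B`.
    search : ∀ m A P B → length A + length A + length P ≤ m → A ++ P ++ B ↭ allFin N →
             Linked _~_ P → Apart A B → length B ≤ length A → Separation
    search m A P B le p link ap B≤A with length A ≟ length B
    ... | yes eq = record { left = A ; stack = P ; right = B
                          ; perm = p ; linked = link ; apart = ap ; balanced = eq }
    search m [] P [] le p link ap B≤A | no neq = contradiction refl neq
    search (suc m) (a ∷ A) [] B (s≤s le) p link ap B≤A | no neq =
      search m A [ a ] B (≤-trans (≤-reflexive (arith (length A))) le)
        (↭-trans (shift a A B) p) [-] (ap ∘ there) (s≤s⁻¹ (≤∧≢⇒< B≤A (neq ∘ sym)))
      where
      arith : ∀ a → a + a + 1 ≡ a + suc a + 0
      arith = solve-∀
    search (suc m) A@(_ ∷ _) P@(x ∷ P′) B le p link ap B≤A | no neq with any? (x ~?_) A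
    ... | no none = search m A P′ (x ∷ B)
      (s≤s⁻¹ (≤-trans (≤-reflexive (sym (+-suc (length A + length A) (length P′)))) le))
      (↭-trans (↭-++⁺ˡ A (shift x P′ B)) p) (tail link)
      (λ { y∈A (here refl) y~x → none (lose y∈A (~-sym y~x)) ; y∈A (there z∈B) → ap y∈A z∈B })
      (≤∧≢⇒< B≤A (neq ∘ sym))

    ... | yes found with find found
    ...   | y , y∈A , xy with ∈-∃++ y∈A
    ...     | as , bs , eq′ = search m (as ++ bs) (y ∷ P) B
      (s≤s⁻¹ (≤-trans (≤-reflexive (arith (length (as ++ bs)) (length P)))
        (subst (λ a → a + a + length P ≤ suc m) size le)))
      (↭-trans (↭-trans (shift y (as ++ bs) (P ++ B)) (↭-++⁺ʳ (P ++ B) (↭-sym (shift y as bs))))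
        (subst (λ A → A ++ P ++ B ↭ allFin N) eq′ p))
      (~-sym xy ∷ link)
      (λ {u} u∈ → ap (subst (u ∈_) (sym eq′) (∈-resp-↭ (↭-sym (shift y as bs)) (there u∈))))
      (s≤s⁻¹ (subst (suc (length B) ≤_) size (≤∧≢⇒< B≤A (neq ∘ sym))))
      where
      size : length A ≡ suc (length (as ++ bs))
      size = trans (cong length eq′) (↭-length (shift y as bs))
      arith : ∀ a p → suc (a + a + suc p) ≡ suc a + suc a + p
      arith = solve-∀

  -- Bad and good vertices, and the part of the upper bound common to even and odd `m`.

  bad? : ∀ q C → Decidable (λ z → q < nonDeg z C)
  bad? q C z = q <? nonDeg z C

  bad good : ℕ → List V → List V
  bad  q C = filter (bad? q C) C
  good q C = filter (¬? ∘ bad? q C) C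

  bad+good : ∀ q C → length (bad q C) + length (good q C) ≡ length C
  bad+good q C = length-filter-¬ (bad? q C) C

  ∈-bad⁻ : ∀ {q} C {z} → z ∈ bad q C → z ∈ C × q < nonDeg z C
  ∈-bad⁻ {q} C = ∈-filter⁻ (bad? q C) {xs = C}

  ∈-good⁻ : ∀ {q} C {z} → z ∈ good q C → z ∈ C × ¬ q < nonDeg z C
  ∈-good⁻ {q} C = ∈-filter⁻ (¬? ∘ bad? q C) {xs = C}

  -- Passing to a sublist can only lower the number of non-neighbours.
  good-nearClique : ∀ q C → NearClique q (good q C)
  good-nearClique q C {z} z∈ =
    ≤-trans (filter-mono (λ y → ¬? (z ~? y)) _ C) (≮⇒≥ (proj₂ (∈-good⁻ C z∈)))

  nearClique⇒∃nbr : ∀ {q C z} → NearClique q C → q < length C → z ∈ C → ∃ λ y → y ∈ C × z ~ y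
  nearClique⇒∃nbr {q} {C} {z} near q<C z∈C with any? (z ~?_) C
  ... | yes found = find found
  ... | no none = contradiction
    (subst (_≤ q) (nonDeg-isolated z C (λ y∈ zy → none (lose y∈ zy))) (near z∈C)) (<⇒≱ q<C)

  -- R stands for the disjunction to be proved; any path on n vertices gives R.
  -- By `sparse`, if C and D are apart then C has at most e bad vertices, since
  -- otherwise the Jahangir graph appears in the complement.
  module Dichotomy (n q a e : ℕ) (R : Set)
    (hasPath : ∀ L → Unique L → Linked _~_ L → n ≤ length L → R)
    -- The number `e` of bad vertices tolerated on each side is 0 for even `m` and 1 for odd `m`.
    (size : N + 1 ≡ n + n + e)
    (e≤1 : e ≤ 1) (0<n : 0 < n)
    -- Mostly, `t` is the common size of the two sides found by the search. The summand `e` lets the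
    -- bounds survive the removal of the bad vertices. They serve, in turn, `sparse`, Hamiltonian
    -- paths, and neighbours within a side.
    (big : ∀ t → n + e ≤ t + t → a + e ≤ t × 3 * q + e ≤ t + 2 × q + e < t)
    (sparse : ∀ C D → Unique C → Unique D → Disjoint C D → Apart C D →
              a ≤ length C → a ≤ length D → R ⊎ length (bad q C) ≤ e)
    where

    -- Hamiltonian paths of `C` and `D` that start at the two neighbours of `z` are joined through
    -- `z`, the first one reversed.
    bridge : ∀ {C D z v w} → NearClique q C → NearClique q D → Unique C → Unique D →
             3 * q ≤ length C + 2 → 3 * q ≤ length D + 2 → Disjoint C D →
             z ∉ C → z ∉ D → v ∈ C → w ∈ D → z ~ v → z ~ w →
             n ≤ suc (length C + length D) → R
    bridge {C} {D} {z} {v} {w} nC nD uC uD bC bD disj z∉C z∉D v∈C w∈D zv zw le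
      with hamiltonianPath nC bC v∈C | hamiltonianPath nD bD w∈D
    ... | M , linkM , pM | M′ , linkM′ , pM′ =
      hasPath (M ʳ++ (v ∷ z ∷ w ∷ M′))
        (Unique-resp-↭ (↭-sym perm)
          (Unique-∷ ([ z∉C , z∉D ]′ ∘ ∈-++⁻ C) (Uniq.++⁺ uC uD disj)))
        (Linked-ʳ++ linkM (~-sym zv ∷ zw ∷ linkM′))
        (≤-trans le (≤-reflexive (trans (cong suc (sym (length-++ C))) (sym (↭-length perm)))))
      where
      perm : M ʳ++ (v ∷ z ∷ w ∷ M′) ↭ z ∷ C ++ D
      perm = ↭-trans (↭-sym (++↭ʳ++ M _)) (↭-trans (shift v M _)
        (↭-trans (shift z (v ∷ M) _)
          (↭-prep z (↭-trans (↭-++⁺ʳ _ pM) (↭-++⁺ˡ C pM′)))))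

    extend : ∀ {C z w} → NearClique q C → Unique C → 3 * q ≤ length C + 2 →
             z ∉ C → w ∈ C → z ~ w → n ≤ suc (length C) → R
    extend {C} {z} near u b z∉C w∈C zw le with hamiltonianPath near b w∈C
    ... | M , link , p = hasPath (z ∷ _ ∷ M) (Unique-resp-↭ (↭-sym (↭-prep z p)) (Unique-∷ z∉C u))
      (zw ∷ link) (≤-trans le (≤-reflexive (cong suc (sym (↭-length p)))))

    spanning : ∀ {C} → NearClique q C → Unique C → 3 * q ≤ length C + 2 → n ≤ length C → R
    spanning {[]} _ _ _ n≤0 = contradiction n≤0 (<⇒≱ 0<n)
    spanning {c ∷ C} near u b le with hamiltonianPath near b (here refl)
    ... | M , link , p = hasPath (c ∷ M) (Unique-resp-↭ (↭-sym p) u) link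
      (≤-trans le (≤-reflexive (sym (↭-length p))))

    good-size : ∀ C → length (bad q C) ≤ e → length C ≤ length (good q C) + e
    good-size C b≤e = ≤-trans (≤-reflexive (sym (bad+good q C)))
      (≤-trans (+-monoˡ-≤ _ b≤e) (≤-reflexive (+-comm e _)))

    n-big : 3 * q + e ≤ n + 2
    n-big = proj₁ (proj₂ (big n (+-monoʳ-≤ n (≤-trans e≤1 0<n))))

    -- The one situation left to each parity of `m`: the two parts cover all vertices, and neither
    -- has `n` good vertices to form a path by themselves.
    Final : Set
    Final = ∀ A B → Unique A → Unique B → Disjoint A B → length A + length B ≡ N →
            length (bad q A) ≤ e → length (bad q B) ≤ e →
            length (good q A) < n → length (good q B) < n → R

    -- The good parts A₀, B₀ of an apart pair are so large that every vertex
    -- with neighbours in both yields a path on n vertices.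
    module Extension (A B : List V) (uA : Unique A) (uB : Unique B) (disj : Disjoint A B)
      (apart : Apart A B) (equal : length A ≡ length B) (long : n + e ≤ length A + length A)
      (badA : length (bad q A) ≤ e) (badB : length (bad q B) ≤ e)
      where

      A₀ B₀ : List V
      A₀ = good q A
      B₀ = good q B

      A₀-size : length A ≤ length A₀ + e
      A₀-size = good-size A badA

      B₀-size : length A ≤ length B₀ + e
      B₀-size = ≤-trans (≤-reflexive equal) (good-size B badB)

      large : ∀ g → length A ≤ g + e → a ≤ g × 3 * q ≤ g + 2 × q < g
      large g le with big (length A) long
      ... | h₁ , h₂ , h₃ =
          +-cancelʳ-≤ e a g (≤-trans h₁ le)
        , +-cancelʳ-≤ e (3 * q) (g + 2) (≤-trans h₂ (≤-trans (+-monoˡ-≤ 2 le)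
            (≤-reflexive (ident g e))))
        , +-cancelʳ-≤ e (suc q) g (≤-trans h₃ le)
        where
        ident : ∀ g e → g + e + 2 ≡ g + 2 + e
        ident = solve-∀

      apart₀ : Apart A₀ B₀
      apart₀ x∈ y∈ = apart (proj₁ (∈-good⁻ A x∈)) (proj₁ (∈-good⁻ B y∈))

      -- The two sides have at least `n + e` vertices and lose at most `2 * e`. The bridging vertex
      -- contributes one, which makes up for the deficit as `e ≤ 1`.
      n≤A₀+B₀ : n ≤ suc (length A₀ + length B₀)
      n≤A₀+B₀ = ≤-certificate n _ 0
        (+-mono-≤ (+-mono-≤ (+-mono-≤ A₀-size B₀-size) long) e≤1)
        (ident n e (length A₀) (length B₀) (length A))
        where
        ident : ∀ n e x y t → n + (x + e + (y + e) + (t + t) + 1) + 0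
                            ≡ suc (x + y) + (t + t + (n + e) + e)
        ident = solve-∀

      nbrIn? : ∀ C → Decidable (λ z → ∃ λ y → y ∈ C × z ~ y)
      nbrIn? C z = map′ find (λ (_ , y∈ , zy) → lose y∈ zy) (any? (z ~?_) C)

      -- A′ contains A₀ and is apart from B₀; B′ contains B₀ and, if no vertex
      -- has neighbours in both A₀ and B₀, is apart from A₀.
      A′ B′ : List V
      A′ = filter (¬? ∘ nbrIn? B₀) (allFin N)
      B′ = filter (nbrIn? B₀) (allFin N)

      A₀⊆A′ : ∀ {z} → z ∈ A₀ → z ∈ A′
      A₀⊆A′ z∈ = ∈-filter⁺ (¬? ∘ nbrIn? B₀) (∈-allFin _) λ (_ , y∈ , zy) → apart₀ z∈ y∈ zy

      -- Membership in `B′` asks for a neighbour in `B₀`; a near-clique on more than `q` vertices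
      -- gives each of its vertices a neighbour inside it.
      B₀⊆B′ : ∀ {z} → z ∈ B₀ → z ∈ B′
      B₀⊆B′ z∈ = ∈-filter⁺ (nbrIn? B₀) (∈-allFin _)
        (nearClique⇒∃nbr (good-nearClique q B) (proj₂ (proj₂ (large _ B₀-size))) z∈)

      A′-noNbr : ∀ {z} → z ∈ A′ → ¬ (∃ λ y → y ∈ B₀ × z ~ y)
      A′-noNbr z∈ = proj₂ (∈-filter⁻ (¬? ∘ nbrIn? B₀) {xs = allFin N} z∈)

      B′-nbr : ∀ {z} → z ∈ B′ → ∃ λ y → y ∈ B₀ × z ~ y
      B′-nbr z∈ = proj₂ (∈-filter⁻ (nbrIn? B₀) {xs = allFin N} z∈)

      disj′ : Disjoint A′ B′
      disj′ (z∈A′ , z∈B′) = A′-noNbr z∈A′ (B′-nbr z∈B′)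

      uA₀ : Unique A₀
      uA₀ = Uniq.filter⁺ _ uA

      uB₀ : Unique B₀
      uB₀ = Uniq.filter⁺ _ uB

      uA′ : Unique A′
      uA′ = Uniq.filter⁺ _ (Uniq.allFin⁺ N)

      uB′ : Unique B′
      uB′ = Uniq.filter⁺ _ (Uniq.allFin⁺ N)

      size′ : length A′ + length B′ ≡ N
      size′ = trans (+-comm (length A′) _)
        (trans (length-filter-¬ (nbrIn? B₀) (allFin N)) (length-tabulate id))

      finish : ∀ {C} → Unique C → n ≤ length (good q C) → R
      finish {C} uC le = spanning (good-nearClique q C) (Uniq.filter⁺ _ uC)
        (≤-trans (m≤m+n _ e) (≤-trans n-big (+-monoˡ-≤ 2 le))) le

      conclude : Final → R
      conclude final with any? (λ z → nbrIn? A₀ z ×-dec nbrIn? B₀ z) (allFin N)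
      ... | yes found with find found
      ...   | z , _ , (v , v∈ , zv) , (w , w∈ , zw) =
        bridge (good-nearClique q A) (good-nearClique q B) uA₀ uB₀
          (proj₁ (proj₂ (large _ A₀-size))) (proj₁ (proj₂ (large _ B₀-size)))
          (λ (x∈ , x∈′) → disj (proj₁ (∈-good⁻ A x∈) , proj₁ (∈-good⁻ B x∈′)))
          (λ z∈ → apart₀ z∈ w∈ zw) (λ z∈ → apart₀ v∈ z∈ (~-sym zv))
          v∈ w∈ zv zw n≤A₀+B₀
      -- There may be edges between `A′` and `B′`. For `sparse` it is enough to test each of them
      -- against the good core of the other side.
      conclude final | no none
        with sparse A′ B₀ uA′ uB₀ (λ (x∈ , x∈′) → disj′ (x∈ , B₀⊆B′ x∈′))
               (λ x∈ y∈ xy → A′-noNbr x∈ (_ , y∈ , xy))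
               (≤-trans (proj₁ (large _ A₀-size)) (Unique-⊆⇒length≤ uA₀ A₀⊆A′))
               (proj₁ (large _ B₀-size))
           | sparse B′ A₀ uB′ uA₀ (λ (x∈ , x∈′) → disj′ (A₀⊆A′ x∈′ , x∈))
               (λ x∈ y∈ xy → none (lose (∈-allFin _) ((_ , y∈ , xy) , B′-nbr x∈)))
               (≤-trans (proj₁ (large _ B₀-size)) (Unique-⊆⇒length≤ uB₀ B₀⊆B′))
               (proj₁ (large _ A₀-size))
      ... | inj₁ r     | _          = r
      ... | inj₂ _     | inj₁ r     = r
      ... | inj₂ badA′ | inj₂ badB′ with n ≤? length (good q A′) | n ≤? length (good q B′)
      ...   | yes le | _      = finish uA′ le
      ...   | no _   | yes le = finish uB′ le
      ...   | no ¬lA | no ¬lB =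
        final A′ B′ uA′ uB′ disj′ size′ badA′ badB′ (≰⇒> ¬lA) (≰⇒> ¬lB)

    conclude : Final → R
    conclude final = split (Unique-++⁻ left uAll)
      where
      open Separation separate
      uAll : Unique (left ++ stack ++ right)
      uAll = Unique-resp-↭ (↭-sym perm) (Uniq.allFin⁺ N)
      total : length left + (length stack + length right) ≡ N
      total = trans (sym (trans (length-++ left) (cong (length left +_) (length-++ stack))))
        (trans (↭-length perm) (length-tabulate id))
      -- The two sides together have `N - length stack` vertices, at least
      -- `(2 * n + e - 1) - (n - 1)`.
      long : length stack < n → n + e ≤ length left + length left
      long s<n = arith (length left) (length stack) s<n
        (subst (λ r → length left + (length stack + r) ≡ N) (sym balanced) total)
        where
        ident : ∀ n e s t → n + e + (n + (t + (s + t) + 1)) + 0 ≡ t + t + (suc s + (n + n + e))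
        ident = solve-∀
        arith : ∀ t s → s < n → t + (s + t) ≡ N → n + e ≤ t + t
        arith t s s<n eq = ≤-certificate (n + e) (t + t) 0
          (+-mono-≤ s<n (≤-reflexive (trans (sym size) (cong (_+ 1) (sym eq)))))
          (ident n e s t)
      split : Unique left × Unique (stack ++ right) × Disjoint left (stack ++ right) → R
      split (uL , uSR , disj) with Unique-++⁻ stack uSR | n ≤? length stack
      ... | uS , _  , _ | yes le = hasPath stack uS linked le
      ... | _  , uR , _ | no ¬le
        with sparse left right uL uR disjLR apart aL aR
           | sparse right left uR uL (λ (x∈ , x∈′) → disjLR (x∈′ , x∈)) (Apart-sym apart) aR aL
        where
        disjLR : Disjoint left right
        disjLR (x∈ , x∈′) = disj (x∈ , ∈-++⁺ʳ stack x∈′)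
        aL : a ≤ length left
        aL = ≤-trans (m≤m+n a e) (proj₁ (big _ (long (≰⇒> ¬le))))
        aR : a ≤ length right
        aR = subst (a ≤_) balanced aL
      ... | inj₁ r | _      = r
      ... | inj₂ _ | inj₁ r = r
      ... | inj₂ badL | inj₂ badR =
        Extension.conclude left right uL uR (λ (x∈ , x∈′) → disj (x∈ , ∈-++⁺ʳ stack x∈′))
          apart balanced (long (≰⇒> ¬le)) badL badR final

-- Alternating lists, and embeddings of the path and the Jahangir graph.

module _ {A : Set} where

  zipAlt : List A → List A → List A
  zipAlt (x ∷ xs) (y ∷ ys) = x ∷ y ∷ zipAlt xs ys
  zipAlt _        _        = []

  zipAlt-↭ : ∀ xs ys → length xs ≡ length ys → zipAlt xs ys ↭ xs ++ ys
  zipAlt-↭ []       []       _  = ↭-refl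
  zipAlt-↭ (x ∷ xs) (y ∷ ys) eq = ↭-prep x
    (↭-trans (↭-prep y (zipAlt-↭ xs ys (suc-injective eq))) (↭-sym (shift y xs ys)))

  module _ {R : A → A → Set} where

    -- In the induction the last `y` placed takes over the role of `p`, so `p` has to be related
    -- only to `xs` and to the end `q`, which it meets once the lists are empty.
    Linked-zipAlt : ∀ {p q} xs ys → length xs ≡ length ys → R p q →
                    (∀ {x} → x ∈ xs → R p x) → (∀ {y} → y ∈ ys → R y q) →
                    (∀ {x y} → x ∈ xs → y ∈ ys → R x y × R y x) →
                    Linked R (p ∷ zipAlt xs ys ++ [ q ])
    Linked-zipAlt []       []       _  pq px yq xy = pq ∷ [-]
    Linked-zipAlt (x ∷ xs) (y ∷ ys) eq pq px yq xy =
      px (here refl) ∷ proj₁ (xy (here refl) (here refl)) ∷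
      Linked-zipAlt xs ys (suc-injective eq) (yq (here refl))
        (λ x∈ → proj₂ (xy (there x∈) (here refl))) (yq ∘ there)
        (λ x∈ y∈ → xy (there x∈) (there y∈))

module _ {N : ℕ} (F : Graph N) where

  open InGraph F

  infix 4 _≁_
  _≁_ : V → V → Set
  x ≁ y = ¬ x ~ y

  ≁-sym : ∀ {x y} → x ≁ y → y ≁ x
  ≁-sym xy yx = xy (~-sym yx)

  path-embedding : ∀ {n} L → Unique L → Linked _~_ L → n ≤ length L →
                   path n IsSubgraphOf F
  path-embedding {n} L u link n≤L = f , injective , λ {i} {j} → preserves {i} {j}
    where
    f : Fin n → V
    f i = lookup L (Data.Fin.inject≤ i n≤L)
    injective : Injective _≡_ _≡_ f
    injective eq = Fin.inject≤-injective n≤L n≤L _ _ (lookup-injective u eq)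
    consecutive : ∀ i j → toℕ j ≡ suc (toℕ i) → f i ~ f j
    consecutive i j eq = lookup-consecutive link _ _
      (trans (Fin.toℕ-inject≤ j n≤L) (trans eq (cong suc (sym (Fin.toℕ-inject≤ i n≤L)))))
    preserves : ∀ {i j} → Adj (path n) i j → f i ~ f j
    preserves (_ , inj₁ eq) = consecutive _ _ eq
    preserves (_ , inj₂ eq) = ~-sym (consecutive _ _ eq)

  module _ (s m : ℕ) (s≥3 : s ≥ 3) where

    -- The spokes end at positions divisible by s ≥ 3, so x₁ and x₂ may be
    -- adjacent to the hub z.
    jahangir-embedding : ∀ {z x₀ x₁ x₂ rest} →
      let C = x₀ ∷ x₁ ∷ x₂ ∷ rest in
      length C ≡ s * m → Unique (z ∷ C) → Linked _≁_ (C ++ [ x₀ ]) →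
      z ≁ x₀ → (∀ {y} → y ∈ rest → z ≁ y) →
      jahangir s m IsSubgraphOf complement F
    jahangir-embedding {z} {x₀} {x₁} {x₂} {rest} len (z∉ ∷ u) link z≁x₀ z≁rest =
      f , injective , λ {i} {j} adj → f-≢ (edge-≢ adj) , preserves i j adj
      where
      C = x₀ ∷ x₁ ∷ x₂ ∷ rest
      g : Fin (s * m) → V
      g i = lookup C (cast (sym len) i)
      g-injective : Injective _≡_ _≡_ g
      g-injective {i} {j} eq = Fin.toℕ-injective (trans (sym (Fin.toℕ-cast (sym len) i))
        (trans (cong toℕ (lookup-injective u eq)) (Fin.toℕ-cast (sym len) j)))
      f : Fin (suc (s * m)) → V
      f zero    = z
      f (suc i) = g i
      injective : Injective _≡_ _≡_ f
      injective {zero}  {zero}  _  = refl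
      injective {zero}  {suc j} eq = contradiction eq (All.lookup z∉ (∈-lookup (cast (sym len) j)))
      injective {suc i} {zero}  eq = contradiction (sym eq) (All.lookup z∉ (∈-lookup (cast (sym len) i)))
      injective {suc i} {suc j} eq = cong suc (g-injective eq)
      edge-≢ : ∀ {i j} → Adj (jahangir s m) i j → i ≢ j
      edge-≢ adj eq = Graph.irrefl (jahangir s m) eq adj
      f-≢ : ∀ {i j} → i ≢ j → f i ≢ f j
      f-≢ i≢j eq = i≢j (injective eq)
      spoke : ∀ (i : Fin (length C)) → s ∣ toℕ i → z ≁ lookup C i
      spoke zero                  _   = z≁x₀
      spoke (suc zero)            s∣1 = contradiction (≤-trans s≥3 (∣⇒≤ s∣1)) λ { (s≤s ()) }
      spoke (suc (suc zero))      s∣2 = contradiction (≤-trans s≥3 (∣⇒≤ s∣2)) λ { (s≤s (s≤s ())) }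
      spoke (suc (suc (suc i)))   _   = z≁rest (∈-lookup i)
      first : ∀ (j : Fin (length C)) → toℕ j ≡ 0 → lookup C j ≡ x₀
      first zero _ = refl
      arc : ∀ i j → toℕ j ≡ suc (toℕ i) ⊎ (suc (toℕ i) ≡ s * m × toℕ j ≡ 0) → g i ≁ g j
      arc i j (inj₁ eq) = lookup-consecutive (Linked-++⁻ˡ C link) _ _
        (trans (Fin.toℕ-cast (sym len) j) (trans eq (cong suc (sym (Fin.toℕ-cast (sym len) i)))))
      arc i j (inj₂ (last , eq)) = subst (g i ≁_) (sym (first _ (trans (Fin.toℕ-cast (sym len) j) eq)))
        (lookup-last C link _ (trans (cong suc (Fin.toℕ-cast (sym len) i)) (trans last (sym len))))
      preserves : ∀ i j → Adj (jahangir s m) i j → f i ≁ f j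
      preserves zero    (suc j) s∣j = spoke _ (subst (s ∣_) (sym (Fin.toℕ-cast (sym len) j)) s∣j)
      preserves (suc i) zero    s∣i = ≁-sym (spoke _ (subst (s ∣_) (sym (Fin.toℕ-cast (sym len) i)) s∣i))
      preserves (suc i) (suc j) (_ , inj₁ r) = arc i j r
      preserves (suc i) (suc j) (_ , inj₂ r) = ≁-sym (arc j i r)

    -- The rim is `x₀ x₁ p` followed by an alternating stretch of even length, hence odd. At
    -- positions 1 and 2, `x₁` and `p` carry no spoke and may be adjacent to `z`.
    alternating-embedding : ∀ {z x₀ x₁ p} xs ys → length xs ≡ length ys →
      3 + (length xs + length ys) ≡ s * m →
      Unique (z ∷ x₀ ∷ x₁ ∷ p ∷ xs ++ ys) → x₀ ≁ x₁ → x₁ ≁ p → p ≁ x₀ →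
      (∀ {x} → x ∈ xs → p ≁ x) → (∀ {y} → y ∈ ys → y ≁ x₀) → Apart xs ys →
      z ≁ x₀ → (∀ {y} → y ∈ xs ++ ys → z ≁ y) →
      jahangir s m IsSubgraphOf complement F
    alternating-embedding {z} {x₀} {x₁} {p} xs ys eq len u x₀x₁ x₁p px₀ px yx₀ ap zx₀ zxy =
      jahangir-embedding
        (trans (cong (3 +_) (trans (↭-length perm) (length-++ xs))) len)
        (Unique-resp-↭ (↭-sym (↭-prep z (↭-prep x₀ (↭-prep x₁ (↭-prep p perm))))) u)
        (x₀x₁ ∷ x₁p ∷ Linked-zipAlt {R = _≁_} xs ys eq px₀ px yx₀
          (λ x∈ y∈ → ap x∈ y∈ , ≁-sym (ap x∈ y∈)))
        zx₀ (zxy ∘ ∈-resp-↭ perm)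
      where
      perm = zipAlt-↭ xs ys eq

-- Lower bound: colourings of the Jahangir graph, and disjoint cliques.

<2-≢-≢⇒≡ : ∀ {x y z} → x < 2 → y < 2 → z < 2 → x ≢ y → y ≢ z → x ≡ z
<2-≢-≢⇒≡ {0} {0} x<2 y<2 z<2 x≢y y≢z = contradiction refl x≢y
<2-≢-≢⇒≡ {1} {1} x<2 y<2 z<2 x≢y y≢z = contradiction refl x≢y
<2-≢-≢⇒≡ {0} {1} {0} x<2 y<2 z<2 x≢y y≢z = refl
<2-≢-≢⇒≡ {0} {1} {1} x<2 y<2 z<2 x≢y y≢z = contradiction refl y≢z
<2-≢-≢⇒≡ {1} {0} {0} x<2 y<2 z<2 x≢y y≢z = contradiction refl y≢z
<2-≢-≢⇒≡ {1} {0} {1} x<2 y<2 z<2 x≢y y≢z = refl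
<2-≢-≢⇒≡ {suc (suc _)} (s≤s (s≤s ()))
<2-≢-≢⇒≡ {0} {suc (suc _)} _ (s≤s (s≤s ()))
<2-≢-≢⇒≡ {1} {suc (suc _)} _ (s≤s (s≤s ()))
<2-≢-≢⇒≡ {0} {1} {suc (suc _)} _ _ (s≤s (s≤s ()))
<2-≢-≢⇒≡ {1} {0} {suc (suc _)} _ _ (s≤s (s≤s ()))

-- With two colours, two steps lead back to the same colour, so the walk can be shortened by two
-- until a single edge is left.
odd-walk : ∀ (c : ℕ → ℕ) i h → (∀ j → j ≤ suc (h + h) → c (i + j) < 2) →
           (∀ j → j < suc (h + h) → c (i + j) ≢ c (suc (i + j))) →
           c i ≢ c (i + suc (h + h))
odd-walk c i zero    small proper eq =
  proper 0 (s≤s z≤n) (trans (cong c (+-identityʳ i)) (trans eq (cong c (+-suc i 0))))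
odd-walk c i (suc h) small proper eq =
  odd-walk c i h (λ j le → small j (≤-trans le (≤-trans (n≤1+n _) (≤-trans (n≤1+n _) (≤-reflexive two)))))
    (λ j lt → proper j (≤-trans lt (≤-trans (n≤1+n _) (≤-trans (n≤1+n _) (≤-reflexive two)))))
    (trans eq (trans (cong (λ t → c (i + t)) (sym two)) (sym same)))
  where
  L = suc (h + h)
  two : suc (suc L) ≡ suc (suc h + suc h)
  two = cong (λ t → suc (suc t)) (sym (+-suc h h))
  small′ : ∀ j → j ≤ suc (suc L) → c (i + j) < 2
  small′ j le = small j (≤-trans le (≤-reflexive two))
  proper′ : ∀ j → j < suc (suc L) → c (i + j) ≢ c (i + suc j)
  proper′ j lt e = proper j (≤-trans lt (≤-reflexive two)) (trans e (cong c (+-suc i j)))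
  same : c (i + L) ≡ c (i + suc (suc L))
  same = <2-≢-≢⇒≡ (small′ L (≤-trans (n≤1+n _) (n≤1+n _))) (small′ (suc L) (n≤1+n _))
    (small′ (suc (suc L)) ≤-refl)
    (proper′ L (n≤1+n _)) (proper′ (suc L) ≤-refl)

∃-large-on-odd-walk : ∀ (c : ℕ → ℕ) i h → (∀ j → j < suc (h + h) → c (i + j) ≢ c (suc (i + j))) →
                      c i ≡ c (i + suc (h + h)) →
                      ∃ λ j → j ≤ suc (h + h) × ¬ c (i + j) < 2
∃-large-on-odd-walk c i h proper eq with anyUpTo? (λ j → ¬? (c (i + j) <? 2)) (suc (suc (h + h)))
... | yes (j , lt , large) = j , s≤s⁻¹ lt , large
... | no none = contradiction eq
  (odd-walk c i h (λ j le → ≰⇒> λ 2≤ → none (j , s≤s le , λ lt → <⇒≱ lt 2≤)) proper)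

module Coloured (s m : ℕ) .{{_ : NonZero (s * m)}} (c : Fin (suc (s * m)) → ℕ)
  (proper : ∀ u v → JahangirAdj s m u v → c u ≢ c v) where

  k = s * m

  0<k : 0 < k
  0<k = >-nonZero⁻¹ k

  -- Positions from `k` on are sent to the first cycle vertex. Thus `rim k` closes the cycle, and
  -- walks along the rim are indexed by plain numbers.
  rim : ℕ → Fin (suc k)
  rim j with j <? k
  ... | yes j<k = suc (fromℕ< j<k)
  ... | no  _   = suc (fromℕ< 0<k)

  rim-< : ∀ {j} (j<k : j < k) → rim j ≡ suc (fromℕ< j<k)
  rim-< {j} j<k with j <? k
  ... | yes _ = refl
  ... | no ¬p = contradiction j<k ¬p

  rim-k : rim k ≡ suc (fromℕ< 0<k)
  rim-k with k <? k
  ... | yes p = contradiction p (n≮n k)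
  ... | no _ = refl

  rim-injective : ∀ {i j} → i < k → j < k → rim i ≡ rim j → i ≡ j
  rim-injective i<k j<k eq =
    Fin.fromℕ<-injective _ _ i<k j<k (Fin.suc-injective (trans (sym (rim-< i<k)) (trans eq (rim-< j<k))))

  rim-0 : rim 0 ≡ rim k
  rim-0 = trans (rim-< 0<k) (sym rim-k)

  c-rim : ∀ j → 1 < k → j < k → c (rim j) ≢ c (rim (suc j))
  c-rim j 1<k j<k rewrite rim-< j<k with suc j <? k
  ... | yes sj<k = proper _ _
    ( (λ eq → 1+n≢n (sym (Fin.fromℕ<-injective _ _ j<k sj<k eq)))
    , inj₁ (inj₁ (trans (Fin.toℕ-fromℕ< sj<k) (cong suc (sym (Fin.toℕ-fromℕ< j<k))))))
  ... | no ¬sj<k = proper _ _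
    ( (λ eq → <⇒≢ 1<k (trans (cong suc (sym (Fin.fromℕ<-injective _ _ j<k 0<k eq))) sj≡k))
    , inj₁ (inj₂ (trans (cong suc (Fin.toℕ-fromℕ< j<k)) sj≡k , Fin.toℕ-fromℕ< 0<k)))
    where
    sj≡k : suc j ≡ k
    sj≡k = ≤-antisym j<k (≮⇒≥ ¬sj<k)

  c-spoke : ∀ j → j ≤ k → s ∣ j → c zero ≢ c (rim j)
  c-spoke j j≤k s∣j with j <? k
  ... | yes j<k = proper _ _ (subst (s ∣_) (sym (Fin.toℕ-fromℕ< j<k)) s∣j)
  ... | no  _   = proper _ _ (subst (s ∣_) (sym (Fin.toℕ-fromℕ< 0<k)) (s ∣0))

  -- The hub and an odd arc of the rim between two spokes form an odd cycle.
  large-on-arc : ∀ i h → 1 < k → i + suc (h + h) ≤ k → s ∣ i → s ∣ suc (h + h) → c zero < 2 →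
           ∃ λ j → j ≤ suc (h + h) × ¬ c (rim (i + j)) < 2
  large-on-arc i h 1<k le s∣i s∣L hub with c (rim i) <? 2 | c (rim (i + suc (h + h))) <? 2
  ... | no ¬l | _ = 0 , z≤n , subst (λ t → ¬ c (rim t) < 2) (sym (+-identityʳ i)) ¬l
  ... | yes _ | no ¬l = suc (h + h) , ≤-refl , ¬l
  -- Both ends of the arc have the one colour below 2 that the hub does not have.
  ... | yes l | yes l′ = ∃-large-on-odd-walk (c ∘ rim) i h
    (λ j lt → c-rim (i + j) 1<k (<-≤-trans (+-monoʳ-< i lt) le))
    (<2-≢-≢⇒≡ l hub l′ (c-spoke i (≤-trans (m≤m+n i _) le) s∣i ∘ sym)
      (c-spoke _ le (∣m∣n⇒∣m+n s∣i s∣L)))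

  not-bipartite : 2 ≤ m → (∃ λ h → s ≡ suc (h + h)) → ¬ (∀ u → c u < 2)
  not-bipartite 2≤m (h , refl) small
    with large-on-arc 0 h (≤-trans 2≤m (m≤n*m m s)) s≤k (s ∣0) ∣-refl (small zero)
    where
    s≤k : s ≤ k
    s≤k = m≤m*n s m {{>-nonZero (≤-trans (n≤1+n _) 2≤m)}}
  ... | _ , _ , ¬small = ¬small (small _)

  -- Every rim vertex avoids one of the arcs [0, s], [s, 2s] and [2s, k].
  not-almost-bipartite : 3 ≤ m → (∃ λ h → s ≡ suc (h + h)) →
    (∃ λ h → s + s + suc (h + h) ≡ k × s ∣ suc (h + h)) → (∃ λ h → k ≡ suc (h + h)) →
    ¬ (∀ u v → ¬ c u < 2 → ¬ c v < 2 → u ≡ v)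
  not-almost-bipartite 3≤m (h , refl) (h′ , eq , s∣L) (h″ , k≡) unique = ⊥-elim absurd
    where
    2s<k : s + s < k
    2s<k = ≤-trans (m<m+n (s + s) (s≤s z≤n)) (≤-reflexive eq)
    s<k : s < k
    s<k = ≤-<-trans (m≤m+n s s) 2s<k
    1<k : 1 < k
    1<k = ≤-trans (≤-trans (n≤1+n 2) 3≤m) (m≤n*m m s)
    absurd : ⊥
    absurd with c zero <? 2
    -- If the hub is the exceptional vertex, the rim itself is an odd closed walk in two colours.
    ... | no hub = contradiction (cong c rim-0)
      (subst (λ t → c (rim 0) ≢ c (rim t)) (sym k≡) (odd-walk (c ∘ rim) 0 h″
        (λ j _ → ≰⇒> λ 2≤ → hub≢rim j (unique zero (rim j) hub (≤⇒≯ 2≤)))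
        (λ j lt → c-rim j 1<k (<-≤-trans lt (≤-reflexive (sym k≡))))))
      where
      hub≢rim : ∀ j → zero ≢ rim j
      hub≢rim j e with j <? k
      hub≢rim j () | yes _
      hub≢rim j () | no _
    ... | yes hub
      with large-on-arc 0 h 1<k (<⇒≤ s<k) (s ∣0) ∣-refl hub
         | large-on-arc s h 1<k (<⇒≤ 2s<k) ∣-refl ∣-refl hub
         | large-on-arc (s + s) h′ 1<k (≤-reflexive eq) (∣m∣n⇒∣m+n ∣-refl ∣-refl) s∣L hub
    ... | i , i≤s , ¬i | j , j≤s , ¬j | l , l≤ , ¬l = third (s + s + l <? k)
      where
      s+j<k : s + j < k
      s+j<k = ≤-<-trans (+-monoʳ-≤ s j≤s) 2s<k
      -- The exceptional vertices of the three arcs coincide. The first two arcs share only position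
      -- `s`, which the third arc avoids.
      i≡s+j : i ≡ s + j
      i≡s+j = rim-injective (≤-<-trans i≤s s<k) s+j<k (unique _ _ ¬i ¬j)
      i≡s : i ≡ s
      i≡s = ≤-antisym i≤s (≤-trans (m≤m+n s j) (≤-reflexive (sym i≡s+j)))
      third : Dec (s + s + l < k) → ⊥
      third (yes lt) = <⇒≢ (<-≤-trans (m<m+n s (s≤s z≤n)) (m≤m+n (s + s) l))
        (trans (sym i≡s) (rim-injective (≤-<-trans i≤s s<k) lt (unique _ _ ¬i ¬l)))
      third (no ¬lt) = 0≢1+n (trans (rim-injective 0<k (≤-<-trans i≤s s<k)
        (trans rim-0 (trans (cong rim k≡ssl) (unique _ _ ¬l ¬i)))) i≡s)
        where
        k≡ssl : k ≡ s + s + l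
        k≡ssl = ≤-antisym (≮⇒≥ ¬lt) (≤-trans (+-monoʳ-≤ (s + s) l≤) (≤-reflexive eq))

-- Disjoint cliques on `d` consecutive vertices each, the last one possibly smaller. The quotient by
-- `d` names the clique and so properly colours the complement.
blocks : ∀ M d .{{_ : NonZero d}} → Graph M
blocks M d = record
  { Adj    = λ u v → u ≢ v × toℕ u / d ≡ toℕ v / d
  ; adj?   = λ u v → ¬? (u Fin.≟ v) ×-dec (toℕ u / d ≟ toℕ v / d)
  ; sym    = λ (u≢v , eq) → ≢-sym u≢v , sym eq
  ; irrefl = λ u≡v (u≢v , _) → u≢v u≡v
  }

-- A path never leaves its block, so its vertices share one quotient, while two of `d + 1` vertices
-- also share the remainder.
blocks-noPath : ∀ M d .{{_ : NonZero d}} → ¬ path (suc d) IsSubgraphOf blocks M d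
blocks-noPath M d (f , injective , preserves) =
  let i , j , i<j , eq = Fin.pigeonhole (n<1+n d) g in
  <⇒≢ i<j (cong toℕ (injective (Fin.toℕ-injective (same-code i j eq))))
  where
  g : Fin (suc d) → Fin d
  g i = fromℕ< (m%n<n (toℕ (f i)) d)
  block-step : ∀ {t} (t<d : suc t < suc d) (t<d′ : t < suc d) →
               toℕ (f (fromℕ< t<d′)) / d ≡ toℕ (f (fromℕ< t<d)) / d
  block-step {t} t<d t<d′ = proj₂ (preserves
    ( (λ eq → 1+n≢n (sym (Fin.fromℕ<-injective _ _ t<d′ t<d eq)))
    , inj₁ (trans (Fin.toℕ-fromℕ< t<d) (cong suc (sym (Fin.toℕ-fromℕ< t<d′))))))
  block-0 : ∀ t (t<d : t < suc d) → toℕ (f (fromℕ< t<d)) / d ≡ toℕ (f zero) / d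
  block-0 zero    _   = refl
  block-0 (suc t) t<d = trans (sym (block-step t<d t<d′)) (block-0 t t<d′)
    where t<d′ = <-trans (n<1+n t) t<d
  block : ∀ i → toℕ (f i) / d ≡ toℕ (f zero) / d
  block i = subst (λ i → toℕ (f i) / d ≡ toℕ (f zero) / d) (Fin.fromℕ<-toℕ i (Fin.toℕ<n i))
    (block-0 (toℕ i) (Fin.toℕ<n i))
  same-code : ∀ i j → g i ≡ g j → toℕ (f i) ≡ toℕ (f j)
  same-code i j eq = begin
    toℕ (f i)                                 ≡⟨ m≡m%n+[m/n]*n (toℕ (f i)) d ⟩
    toℕ (f i) % d + toℕ (f i) / d * d         ≡⟨ cong₂ (λ r t → r + t * d)
      (Fin.fromℕ<-injective _ _ _ _ eq) (trans (block i) (sym (block j))) ⟩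
    toℕ (f j) % d + toℕ (f j) / d * d         ≡⟨ m≡m%n+[m/n]*n (toℕ (f j)) d ⟨
    toℕ (f j)                                 ∎
    where open ≡-Reasoning

blocks-colouring : ∀ {b M} {H : Graph b} d .{{_ : NonZero d}} →
                   ((f , _) : H IsSubgraphOf complement (blocks M d)) →
                   ∀ u v → Adj H u v → toℕ (f u) / d ≢ toℕ (f v) / d
blocks-colouring d (f , _ , preserves) u v uv eq with preserves uv
... | fu≢fv , ¬uv = ¬uv (fu≢fv , eq)

blocks-small : ∀ d .{{_ : NonZero d}} x → x < d + d → x / d < 2
blocks-small d x lt = m<n*o⇒m/o<n (subst (x <_) (cong (d +_) (sym (+-identityʳ d))) lt)

-- With 2d + 1 vertices the third block is a single vertex.
blocks-large : ∀ d .{{_ : NonZero d}} x → x ≤ d + d → ¬ x / d < 2 → x ≡ d + d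
blocks-large d x le ¬small = ≤-antisym le (≮⇒≥ λ lt → ¬small (blocks-small d x lt))

lower-even : ∀ s m d .{{_ : NonZero (s * m)}} .{{_ : NonZero d}} → 2 ≤ m → (∃ λ h → s ≡ suc (h + h)) →
  ∀ M → RamseyProperty (path (suc d)) (jahangir s m) M → d + d < M
lower-even s m d 2≤m odd M ramsey = ≰⇒> λ M≤ → [ blocks-noPath M d , (λ emb →
  Coloured.not-bipartite s m _ (blocks-colouring {H = jahangir s m} d emb) 2≤m odd λ u →
    blocks-small d _ (<-≤-trans (Fin.toℕ<n _) M≤)) ]′ (ramsey (blocks M d))

-- Among at most `2 * d + 1` vertices only the one numbered `2 * d` can have a third colour, and an
-- injective embedding uses it at most once.
lower-odd : ∀ s m d .{{_ : NonZero (s * m)}} .{{_ : NonZero d}} → 3 ≤ m → (∃ λ h → s ≡ suc (h + h)) →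
  (∃ λ h → s + s + suc (h + h) ≡ s * m × s ∣ suc (h + h)) → (∃ λ h → s * m ≡ suc (h + h)) →
  ∀ M → RamseyProperty (path (suc d)) (jahangir s m) M → suc (d + d) < M
lower-odd s m d 3≤m odd odd′ odd″ M ramsey = ≰⇒> λ M≤ → [ blocks-noPath M d , (λ emb →
  Coloured.not-almost-bipartite s m _ (blocks-colouring {H = jahangir s m} d emb)
    3≤m odd odd′ odd″ λ u v ¬u ¬v →
    proj₁ (proj₂ emb) (Fin.toℕ-injective (trans (last M≤ ¬u) (sym (last M≤ ¬v))))) ]′
  (ramsey (blocks M d))
  where
  last : M ≤ suc (d + d) → ∀ {x : Fin M} → ¬ toℕ x / d < 2 → toℕ x ≡ d + d
  last M≤ {x} = blocks-large d (toℕ x) (s≤s⁻¹ (<-≤-trans (Fin.toℕ<n x) M≤))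

-- Upper bound: Jahangir graphs in the complement.

module _ {A : Set} where

  ∃-sublist : ∀ n {xs : List A} → n ≤ length xs → Unique xs →
              ∃ λ ys → length ys ≡ n × Unique ys × (∀ {y} → y ∈ ys → y ∈ xs)
  ∃-sublist zero    _ _ = [] , refl , [] , λ ()
  ∃-sublist (suc n) {x ∷ xs} (s≤s le) (x∉ ∷ u) with ∃-sublist n le u
  ... | ys , len , uys , ⊆xs =
    x ∷ ys , cong suc len , Unique-∷ (λ x∈ → All.lookup x∉ (⊆xs x∈) refl) uys ,
    λ { (here eq) → here eq ; (there y∈) → there (⊆xs y∈) }

module UpperBound {N : ℕ} (F : Graph N) (s m : ℕ) (s≥3 : s ≥ 3) where

  open InGraph F

  Jahangir : Set
  Jahangir = jahangir s m IsSubgraphOf complement F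

  edge? : ∀ C D → (∃₂ λ x y → x ∈ C × y ∈ D × x ~ y) ⊎ Apart C D
  edge? C D with any? (λ x → any? (x ~?_) D) C
  ... | no none = inj₂ λ x∈ y∈ xy → none (lose x∈ (lose y∈ xy))
  ... | yes found with find found
  ...   | x , x∈ , found′ with find found′
  ...     | y , y∈ , xy = inj₁ (x , y , x∈ , y∈ , xy)

  Apart⇒≁ : ∀ {C D x y} → Apart C D → x ∈ C → y ∈ D → ¬ x ~ y × ¬ y ~ x
  Apart⇒≁ apart x∈ y∈ = apart x∈ y∈ , (λ yx → apart x∈ y∈ (~-sym yx))

  -- A bad vertex u of C is the hub, and one vertex x of C may be adjacent to it:
  -- the cycle alternates between C and D.
  sparse-even : ∀ c → s * m ≡ (2 + c) + (2 + c) → ∀ C D → Unique C → Unique D →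
                Disjoint C D → Apart C D → 3 + c ≤ length C → 3 + c ≤ length D →
                Jahangir ⊎ length (bad (1 + c) C) ≤ 0
  sparse-even c k≡ C D uC uD disj apart lC lD with bad (1 + c) C in eq
  ... | [] = inj₂ z≤n
  ... | u ∷ _ = inj₁ (embed
    -- Apart from itself, `u` has at least `1 + c` non-neighbours in `C`. The rim needs one more
    -- vertex of `C`, namely `x`.
    (∃-sublist (1 + c) (s≤s⁻¹ (≤-trans u-bad (≤-trans (length-∖ [ u ] uL) (≤-reflexive (+-comm _ 1)))))
      (Uniq.filter⁺ _ uL))
    (∃-sublist (2 + c) (≤-trans (n≤1+n _) lD) uD))
    where
    u∈ = ∈-bad⁻ C (subst (u ∈_) (sym eq) (here refl))
    u∈C = proj₁ u∈
    u-bad = proj₂ u∈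
    uL : Unique (nonNbrs u C)
    uL = Uniq.filter⁺ _ uC
    embed : ∃ (λ as → length as ≡ 1 + c × Unique as × (∀ {y} → y ∈ as → y ∈ nonNbrs u C ∖ [ u ])) →
            ∃ (λ bs → length bs ≡ 2 + c × Unique bs × (∀ {y} → y ∈ bs → y ∈ D)) → Jahangir
    embed (a₀ ∷ as , la , uas , ⊆L) (b₀ ∷ b₁ ∷ bs , lb , ubs , ⊆D)
      with C ∖ (u ∷ a₀ ∷ as) in eq′ | length-∖ (u ∷ a₀ ∷ as) uC
    ... | [] | le = contradiction (≤-trans lC (≤-trans le (≤-reflexive (cong suc la)))) (n≮n _)
    ... | x ∷ _ | _ =
      jahangir-embedding F s m s≥3
        (trans (cong (4 +_) (trans (↭-length zip) (length-++ as)))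
          (trans (cong₂ (λ i j → 4 + (i + j)) |as| |bs|) (trans (ident c) (sym k≡))))
        (Unique-resp-↭ perm (Uniq.++⁺ uCs ubs (λ (y∈ , y∈′) → disj (Cs⊆C y∈ , ⊆D y∈′))))
        -- The rim starts `a₀ b₀ x b₁`, so `x` stands at position 2, where no spoke ends.
        ( apart (as⊆C (here refl)) (⊆D (here refl))
        ∷ proj₂ (Apart⇒≁ apart x∈C (⊆D (here refl)))
        ∷ apart x∈C (⊆D (there (here refl)))
        ∷ Linked-zipAlt {R = λ x y → ¬ x ~ y} as bs (trans |as| (sym |bs|))
            (proj₂ (Apart⇒≁ apart (as⊆C (here refl)) (⊆D (there (here refl)))))
            (λ a∈ → proj₂ (Apart⇒≁ apart (as⊆C (there a∈)) (⊆D (there (here refl)))))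
            (λ b∈ → proj₂ (Apart⇒≁ apart (as⊆C (here refl)) (⊆D (there (there b∈)))))
            (λ a∈ b∈ → Apart⇒≁ apart (as⊆C (there a∈)) (⊆D (there (there b∈)))))
        (u≁as (here refl))
        λ { (here refl) → apart u∈C (⊆D (there (here refl)))
          ; (there y∈) → [ u≁as ∘ there , apart u∈C ∘ ⊆D ∘ there ∘ there ]′
                           (∈-++⁻ as (∈-resp-↭ zip y∈)) }
      where
      |as| = suc-injective la
      |bs| = suc-injective (suc-injective lb)
      zip = zipAlt-↭ as bs (trans |as| (sym |bs|))
      ident : ∀ c → 4 + (c + c) ≡ (2 + c) + (2 + c)
      ident = solve-∀
      as⊆C : ∀ {y} → y ∈ a₀ ∷ as → y ∈ C
      as⊆C y∈ = proj₁ (∈-nonNbrs⁻ {u} {C} (proj₁ (∈-∖⁻ {xs = nonNbrs u C} (⊆L y∈))))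
      u≁as : ∀ {y} → y ∈ a₀ ∷ as → ¬ u ~ y
      u≁as y∈ = proj₂ (∈-nonNbrs⁻ {u} {C} (proj₁ (∈-∖⁻ {xs = nonNbrs u C} (⊆L y∈))))
      u∉as : u ∉ a₀ ∷ as
      u∉as u∈as = proj₂ (∈-∖⁻ {xs = nonNbrs u C} (⊆L u∈as)) (here refl)
      x∈ = ∈-∖⁻ {xs = C} {ys = u ∷ a₀ ∷ as} (subst (x ∈_) (sym eq′) (here refl))
      x∈C = proj₁ x∈
      uCs : Unique (u ∷ x ∷ a₀ ∷ as)
      uCs = Unique-∷ (λ { (here refl) → proj₂ x∈ (here refl) ; (there u∈as) → u∉as u∈as })
        (Unique-∷ (proj₂ x∈ ∘ there) uas)
      Cs⊆C : ∀ {y} → y ∈ u ∷ x ∷ a₀ ∷ as → y ∈ C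
      Cs⊆C (here refl)         = u∈C
      Cs⊆C (there (here refl)) = x∈C
      Cs⊆C (there (there y∈))  = as⊆C y∈
      perm : (u ∷ x ∷ a₀ ∷ as) ++ (b₀ ∷ b₁ ∷ bs) ↭ u ∷ a₀ ∷ b₀ ∷ x ∷ b₁ ∷ zipAlt as bs
      perm = ↭-prep u (↭-trans (↭-swap x a₀ ↭-refl) (↭-prep a₀
        (↭-trans (shift b₀ (x ∷ as) (b₁ ∷ bs)) (↭-prep b₀ (↭-prep x
          (↭-trans (shift b₁ as bs) (↭-prep b₁ (↭-sym zip))))))))

  -- One bad vertex z of C is the hub. Another one, u, and a non-neighbour w of
  -- u provide the only edge of the cycle inside C.
  sparse-odd : ∀ c → s * m ≡ 3 + (c + c) → ∀ C D → Unique C → Unique D →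
               Disjoint C D → Apart C D → 1 + c ≤ length D →
               Jahangir ⊎ length (bad (2 + c) C) ≤ 1
  sparse-odd c k≡ C D uC uD disj apart lD with bad (2 + c) C in eq | Uniq.filter⁺ (bad? (2 + c) C) uC
  ... | []        | _ = inj₂ z≤n
  ... | _ ∷ []    | _ = inj₂ (s≤s z≤n)
  ... | u ∷ z ∷ _ | (u≢z ∷ _) ∷ _ = inj₁ embed
    where
    u∈ = ∈-bad⁻ C (subst (u ∈_) (sym eq) (here refl))
    z∈ = ∈-bad⁻ C (subst (z ∈_) (sym eq) (there (here refl)))
    u∈C = proj₁ u∈
    z∈C = proj₁ z∈
    embed : Jahangir
    embed with nonNbrs u C ∖ (u ∷ [ z ]) in eq′ | length-∖ (u ∷ [ z ]) (Uniq.filter⁺ (λ y → ¬? (u ~? y)) uC)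
    -- At least three non-neighbours are counted for `u`, so one of them differs from `u` and `z`.
    ... | [] | le = contradiction (≤-trans (proj₂ u∈) le) λ { (s≤s (s≤s ())) }
    ... | w ∷ _ | _ = embed′
      (∃-sublist c (+-cancelʳ-≤ 3 c _ (≤-trans (≤-reflexive (+-comm c 3))
          (≤-trans (proj₂ z∈) (length-∖ (z ∷ u ∷ [ w ]) (Uniq.filter⁺ _ uC)))))
        (Uniq.filter⁺ _ (Uniq.filter⁺ (λ y → ¬? (z ~? y)) uC)))
      (∃-sublist (1 + c) lD uD)
      where
      w∈ = ∈-∖⁻ {xs = nonNbrs u C} {ys = u ∷ [ z ]} (subst (w ∈_) (sym eq′) (here refl))
      w∈C = proj₁ (∈-nonNbrs⁻ {u} {C} (proj₁ w∈))
      u≁w = proj₂ (∈-nonNbrs⁻ {u} {C} (proj₁ w∈))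
      embed′ : ∃ (λ as → length as ≡ c × Unique as ×
                 (∀ {y} → y ∈ as → y ∈ nonNbrs z C ∖ (z ∷ u ∷ [ w ]))) →
               ∃ (λ bs → length bs ≡ 1 + c × Unique bs × (∀ {y} → y ∈ bs → y ∈ D)) → Jahangir
      embed′ (as , la , uas , ⊆L) (b₀ ∷ bs , lb , ubs , ⊆D) =
        -- The rim starts `b₀ w u`, which keeps `w` and `u` off the spokes of the hub `z`.
        alternating-embedding F s m s≥3 bs as (trans |bs| (sym la))
          (trans (cong₂ (λ i j → 3 + (i + j)) |bs| la) (sym k≡))
          (Unique-resp-↭ perm (Uniq.++⁺ uCs ubs (λ (y∈ , y∈′) → disj (Cs⊆C y∈ , ⊆D y∈′))))
          (proj₂ (Apart⇒≁ apart w∈C (⊆D (here refl))))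
          (λ wu → u≁w (~-sym wu))
          (apart u∈C (⊆D (here refl)))
          (λ b∈ → apart u∈C (⊆D (there b∈)))
          (λ a∈ → apart (as⊆C a∈) (⊆D (here refl)))
          (λ b∈ a∈ → proj₂ (Apart⇒≁ apart (as⊆C a∈) (⊆D (there b∈))))
          (apart z∈C (⊆D (here refl)))
          ([ apart z∈C ∘ ⊆D ∘ there , z≁as ]′ ∘ ∈-++⁻ bs)
        where
        |bs| = suc-injective lb
        ∈L : ∀ {y} → y ∈ as → y ∈ nonNbrs z C × y ∉ z ∷ u ∷ [ w ]
        ∈L y∈ = ∈-∖⁻ {xs = nonNbrs z C} (⊆L y∈)
        as⊆C : ∀ {y} → y ∈ as → y ∈ C
        as⊆C y∈ = proj₁ (∈-nonNbrs⁻ {z} {C} (proj₁ (∈L y∈)))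
        z≁as : ∀ {y} → y ∈ as → ¬ z ~ y
        z≁as y∈ = proj₂ (∈-nonNbrs⁻ {z} {C} (proj₁ (∈L y∈)))
        uCs : Unique (z ∷ u ∷ w ∷ as)
        uCs = Unique-∷ (λ { (here z≡u)          → u≢z (sym z≡u)
                          ; (there (here refl)) → proj₂ w∈ (there (here refl))
                          ; (there (there z∈))  → proj₂ (∈L z∈) (here refl) })
          (Unique-∷ (λ { (here refl) → proj₂ w∈ (here refl)
                       ; (there u∈)  → proj₂ (∈L u∈) (there (here refl)) })
            (Unique-∷ (λ w∈ → proj₂ (∈L w∈) (there (there (here refl)))) uas))
        Cs⊆C : ∀ {y} → y ∈ z ∷ u ∷ w ∷ as → y ∈ C
        Cs⊆C (here refl)                 = z∈C
        Cs⊆C (there (here refl))         = u∈C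
        Cs⊆C (there (there (here refl))) = w∈C
        Cs⊆C (there (there (there y∈)))  = as⊆C y∈
        perm : (z ∷ u ∷ w ∷ as) ++ (b₀ ∷ bs) ↭ z ∷ b₀ ∷ w ∷ u ∷ bs ++ as
        perm = ↭-prep z (↭-trans (shift b₀ (u ∷ w ∷ as) bs)
          (↭-prep b₀ (↭-swap u w (↭-++-comm as bs))))

  -- The complement contains the complete tripartite graph with parts {x, y}, G, H.
  tripartite : ∀ c {x y G H} → s * m ≡ 3 + (c + c) →
    Unique (x ∷ G) → Unique (y ∷ H) → Disjoint (x ∷ G) (y ∷ H) →
    Apart (x ∷ [ y ]) (G ++ H) → Apart G H → 1 + c ≤ length G → 1 + c ≤ length H → Jahangir
  tripartite c {x} {y} {G} {H} k≡ (x∉ ∷ uG) (y∉ ∷ uH) disj apart apartGH lG lH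
    with ∃-sublist (1 + c) lG uG | ∃-sublist (1 + c) lH uH
  ... | g₀ ∷ gs , lg , ugs , ⊆G | h₀ ∷ hs , lh , uhs , ⊆H =
    -- The hub is `x` and the rim starts `g₀ y h₀`: no spoke ends at `y`, which may be adjacent to
    -- `x`.
    alternating-embedding F s m s≥3 gs hs (trans |gs| (sym |hs|))
      (trans (cong₂ (λ i j → 3 + (i + j)) |gs| |hs|) (sym k≡))
      (Unique-resp-↭ perm (Uniq.++⁺
        (Unique-∷ (λ x∈ → All.lookup x∉ (⊆G x∈) refl) ugs)
        (Unique-∷ (λ y∈ → All.lookup y∉ (⊆H y∈) refl) uhs)
        (λ (v∈ , v∈′) → disj (there-⊆ ⊆G v∈ , there-⊆ ⊆H v∈′))))
      (proj₂ (Apart⇒≁ apart (there (here refl)) (∈-++⁺ˡ (⊆G (here refl)))))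
      (apart (there (here refl)) (∈-++⁺ʳ G (⊆H (here refl))))
      (proj₂ (Apart⇒≁ apartGH (⊆G (here refl)) (⊆H (here refl))))
      (λ g∈ → proj₂ (Apart⇒≁ apartGH (⊆G (there g∈)) (⊆H (here refl))))
      (λ h∈ → proj₂ (Apart⇒≁ apartGH (⊆G (here refl)) (⊆H (there h∈))))
      (λ g∈ h∈ → apartGH (⊆G (there g∈)) (⊆H (there h∈)))
      (apart (here refl) (∈-++⁺ˡ (⊆G (here refl))))
      (λ v∈ → apart (here refl) ([ ∈-++⁺ˡ ∘ ⊆G ∘ there , ∈-++⁺ʳ G ∘ ⊆H ∘ there ]′ (∈-++⁻ gs v∈)))
    where
    |gs| = suc-injective lg
    |hs| = suc-injective lh
    there-⊆ : ∀ {v w C D} → (∀ {y} → y ∈ C → y ∈ D) → w ∈ v ∷ C → w ∈ v ∷ D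
    there-⊆ ⊆D (here eq)  = here eq
    there-⊆ ⊆D (there w∈) = there (⊆D w∈)
    perm : (x ∷ g₀ ∷ gs) ++ (y ∷ h₀ ∷ hs) ↭ x ∷ g₀ ∷ y ∷ h₀ ∷ gs ++ hs
    perm = ↭-prep x (↭-prep g₀ (↭-trans (shift y gs (h₀ ∷ hs)) (↭-prep y (shift h₀ gs hs))))

  -- Upper bound: the two parities of `m`.

  module _ (n : ℕ) where

    R : Set
    R = path n IsSubgraphOf F ⊎ Jahangir

    upper-even : ∀ b → s * m ≡ (3 + b) + (3 + b) → (3 + b) * ((2 + b) + (2 + b)) ≤ n →
                 N + 1 ≡ n + n + 0 → R
    upper-even b k≡ n-large size = Dich.conclude final
      where
      0<n : 0 < n
      0<n = ≤-trans (s≤s z≤n) n-large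
      big : ∀ t → n + 0 ≤ t + t →
            4 + b + 0 ≤ t × 3 * (2 + b) + 0 ≤ t + 2 × 2 + b + 0 < t
      big t le =
          ≤-certificate (4 + b + 0) t (2 + 4 * b + b * b) t-large (i₁ b t)
        , ≤-certificate (3 * (2 + b) + 0) (t + 2) (2 + 2 * b + b * b) t-large (i₂ b t)
        , ≤-certificate (suc (2 + b + 0)) t (3 + 4 * b + b * b) t-large (i₃ b t)
        where
        double : ∀ b → 2 * ((3 + b) * (2 + b)) ≡ (3 + b) * ((2 + b) + (2 + b)) + 0
        double = solve-∀
        t-large : (3 + b) * (2 + b) ≤ t
        t-large = *-cancelˡ-≤ 2 (≤-trans (≤-reflexive (double b))
          (≤-trans (+-monoˡ-≤ 0 n-large) (≤-trans le (≤-reflexive (cong (t +_) (sym (+-identityʳ t)))))))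
        i₁ : ∀ b t → 4 + b + 0 + t + (2 + 4 * b + b * b) ≡ t + (3 + b) * (2 + b)
        i₁ = solve-∀
        i₂ : ∀ b t → 3 * (2 + b) + 0 + t + (2 + 2 * b + b * b) ≡ t + 2 + (3 + b) * (2 + b)
        i₂ = solve-∀
        i₃ : ∀ b t → suc (2 + b + 0) + t + (3 + 4 * b + b * b) ≡ t + (3 + b) * (2 + b)
        i₃ = solve-∀
      module Dich = Dichotomy n (2 + b) (4 + b) 0 R
        (λ L u link le → inj₁ (path-embedding F L u link le)) size z≤n 0<n big
        (λ C D uC uD disj apart lC lD →
          [ inj₁ ∘ inj₂ , inj₂ ]′ (sparse-even (1 + b) k≡ C D uC uD disj apart lC lD))
      final : Dich.Final
      -- For `e = 0` all vertices are good; of `2 * n - 1` vertices in two parts, one part has at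
      -- least `n`.
      final A B uA uB disj total badA badB goodA goodB = ⊥-elim (n≮n 0
        (≤-certificate 1 0 0
          (+-mono-≤ (+-mono-≤ goodA goodB) (+-mono-≤ (Dich.good-size A badA) (Dich.good-size B badB)))
          (ident n (length A) (length B) (length (good (2 + b) A)) (length (good (2 + b) B))
            (trans (cong (_+ 1) total) size))))
        where
        left : ∀ n g h → 1 + (n + n + (g + 0 + (h + 0))) + 0 ≡ 1 + (g + h) + (n + n + 0)
        left = solve-∀
        right : ∀ A B g h → 1 + (g + h) + (A + B + 1) ≡ 0 + (suc g + suc h + (A + B))
        right = solve-∀
        ident : ∀ n A B g h → A + B + 1 ≡ n + n + 0 →
                1 + (n + n + (g + 0 + (h + 0))) + 0 ≡ 0 + (suc g + suc h + (A + B))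
        ident n A B g h eq = trans (left n g h) (trans (cong (1 + (g + h) +_) (sym eq)) (right A B g h))

    upper-odd : ∀ b → s * m ≡ 3 + ((3 + b) + (3 + b)) → (4 + b) * ((4 + b) + (4 + b)) ≤ n →
                N + 1 ≡ n + n + 1 → R
    upper-odd b k≡ n-large size = Dich.conclude final
      where
      0<n : 0 < n
      0<n = ≤-trans (s≤s z≤n) n-large
      q = 5 + b
      big : ∀ t → n + 1 ≤ t + t →
            4 + b + 1 ≤ t × 3 * (5 + b) + 1 ≤ t + 2 × 5 + b + 1 < t
      big t le =
          ≤-certificate (4 + b + 1) t (12 + 7 * b + b * b) t-large (i₁ b t)
        , ≤-certificate (3 * (5 + b) + 1) (t + 2) (3 + 5 * b + b * b) t-large (i₂ b t)
        , ≤-certificate (suc (5 + b + 1)) t (10 + 7 * b + b * b) t-large (i₃ b t)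
        where
        -- Since `n` is at least twice the square of `4 + b`, the bound `n + 1 ≤ t + t` makes `t`
        -- exceed that square.
        t-large : suc ((4 + b) * (4 + b)) ≤ t
        t-large = ≰⇒> λ t≤ → <⇒≱ (≤-trans (≤-reflexive (+-comm 1 _)) (≤-trans (+-monoˡ-≤ 1 n-large) le))
          (≤-trans (+-mono-≤ t≤ t≤) (≤-reflexive (sym (*-distribˡ-+ (4 + b) (4 + b) (4 + b)))))
        i₁ : ∀ b t → 4 + b + 1 + t + (12 + 7 * b + b * b) ≡ t + suc ((4 + b) * (4 + b))
        i₁ = solve-∀
        i₂ : ∀ b t → 3 * (5 + b) + 1 + t + (3 + 5 * b + b * b) ≡ t + 2 + suc ((4 + b) * (4 + b))
        i₂ = solve-∀
        i₃ : ∀ b t → suc (5 + b + 1) + t + (10 + 7 * b + b * b) ≡ t + suc ((4 + b) * (4 + b))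
        i₃ = solve-∀
      module Dich = Dichotomy n q (4 + b) 1 R
        (λ L u link le → inj₁ (path-embedding F L u link le)) size (s≤s z≤n) 0<n big
        (λ C D uC uD disj apart lC lD →
          [ inj₁ ∘ inj₂ , inj₂ ]′ (sparse-odd (3 + b) k≡ C D uC uD disj apart lD))
      final : Dich.Final
      final A B uA uB disj total badA badB goodA goodB =
        -- Each part has at most `n - 1` good vertices and one bad vertex. As there are `2 * n`
        -- vertices in all, both counts are attained in both parts.
        cases (bad-∃ A (full A B badB total goodB) goodA) (bad-∃ B (full B A badA total′ goodA) goodB)
        where
        G = good q A
        H = good q B
        total′ : length B + length A ≡ N
        total′ = trans (+-comm (length B) _) total
        full : ∀ A B → length (bad q B) ≤ 1 → length A + length B ≡ N →
               length (good q B) < n → n ≤ length A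
        full A B badB total good<n = ≤-certificate n (length A) 0
          (+-mono-≤ (Dich.good-size B badB) good<n)
          (ident n (length A) (length B) (length (good q B)) (trans (cong (_+ 1) total) size))
          where
          left : ∀ n h → n + (h + 1 + n) + 0 ≡ h + (n + n + 1)
          left = solve-∀
          right : ∀ A B h → h + (A + B + 1) ≡ A + (B + suc h)
          right = solve-∀
          ident : ∀ n A B h → A + B + 1 ≡ n + n + 1 → n + (h + 1 + n) + 0 ≡ A + (B + suc h)
          ident n A B h eq = trans (left n h) (trans (cong (h +_) (sym eq)) (right A B h))
        bad-∃ : ∀ A → n ≤ length A → length (good q A) < n → ∃ λ x → x ∈ bad q A
        bad-∃ A le good<n with bad q A | bad+good q A
        ... | []    | eq = contradiction (≤-trans le (≤-reflexive (sym eq))) (<⇒≱ good<n)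
        ... | x ∷ _ | _  = x , here refl
        almost : ∀ A → n ≤ length A → length (bad q A) ≤ 1 → n ≤ suc (length (good q A))
        almost A le bad≤1 = ≤-trans le (≤-trans (Dich.good-size A bad≤1) (≤-reflexive (+-comm _ 1)))
        extend : ∀ A → Unique A → n ≤ length A → length (bad q A) ≤ 1 →
                 ∀ {z w} → z ∉ good q A → w ∈ good q A → z ~ w → R
        extend A uA le bad≤1 z∉ w∈ zw = Dich.extend (good-nearClique q A) (Uniq.filter⁺ _ uA)
          (+-cancelʳ-≤ 1 _ _ (≤-trans Dich.n-big (≤-trans (+-monoˡ-≤ 2 (almost A le bad≤1))
            (≤-reflexive (+-comm 1 _)))))
          z∉ w∈ zw (almost A le bad≤1)
        extendG : ∀ {z w} → z ∉ G → w ∈ G → z ~ w → R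
        extendG = extend A uA (full A B badB total goodB) badA
        extendH : ∀ {z w} → z ∉ H → w ∈ H → z ~ w → R
        extendH = extend B uB (full B A badA total′ goodA) badB
        large : ∀ A → n ≤ length A → length (bad q A) ≤ 1 → 4 + b ≤ length (good q A)
        large A le bad≤1 = s≤s⁻¹ (≤-trans (≤-trans 5+b≤ n-large) (almost A le bad≤1))
          where
          ident : ∀ b → 5 + b + (27 + 15 * b + 2 * (b * b)) ≡ (4 + b) * ((4 + b) + (4 + b))
          ident = solve-∀
          5+b≤ : 5 + b ≤ (4 + b) * ((4 + b) + (4 + b))
          5+b≤ = ≤-trans (m≤m+n (5 + b) _) (≤-reflexive (ident b))
        G⊆A : ∀ {v} → v ∈ G → v ∈ A
        G⊆A v∈ = proj₁ (∈-good⁻ A v∈)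
        H⊆B : ∀ {v} → v ∈ H → v ∈ B
        H⊆B v∈ = proj₁ (∈-good⁻ B v∈)
        bad∉good : ∀ A {x} → x ∈ bad q A → x ∉ good q A
        bad∉good A x∈ x∈good = proj₂ (∈-good⁻ A x∈good) (proj₂ (∈-bad⁻ A x∈))
        cases : (∃ λ x → x ∈ bad q A) → (∃ λ y → y ∈ bad q B) → R
        -- Any edge found here leads from outside into `G` or `H`, and so extends a Hamiltonian path
        -- on `n - 1` vertices by one.
        cases (x , x∈) (y , y∈) with edge? (x ∷ [ y ]) (G ++ H) | edge? G H
        ... | inj₁ (v , w , here refl , w∈ , vw) | _ =
          [ (λ w∈ → extendG (bad∉good A x∈) w∈ vw)
          , (λ w∈ → extendH (λ x∈H → disj (proj₁ (∈-bad⁻ A x∈) , H⊆B x∈H)) w∈ vw)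
          ]′ (∈-++⁻ G w∈)
        ... | inj₁ (v , w , there (here refl) , w∈ , vw) | _ =
          [ (λ w∈ → extendG (λ y∈G → disj (G⊆A y∈G , proj₁ (∈-bad⁻ B y∈))) w∈ vw)
          , (λ w∈ → extendH (bad∉good B y∈) w∈ vw)
          ]′ (∈-++⁻ G w∈)
        ... | inj₂ _ | inj₁ (v , w , v∈ , w∈ , vw) =
          extendH (λ v∈H → disj (G⊆A v∈ , H⊆B v∈H)) w∈ vw
        ... | inj₂ apart | inj₂ apartGH = inj₂ (tripartite (3 + b) k≡
          (Unique-∷ (bad∉good A x∈) (Uniq.filter⁺ _ uA)) (Unique-∷ (bad∉good B y∈) (Uniq.filter⁺ _ uB))
          (λ { (here refl , here refl) → disj (proj₁ (∈-bad⁻ A x∈) , proj₁ (∈-bad⁻ B y∈))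
             ; (here refl , there v∈)  → disj (proj₁ (∈-bad⁻ A x∈) , H⊆B v∈)
             ; (there v∈  , here refl) → disj (G⊆A v∈ , proj₁ (∈-bad⁻ B y∈))
             ; (there v∈  , there v∈′) → disj (G⊆A v∈ , H⊆B v∈′) })
          apart apartGH
          (large A (full A B badB total goodB) badA) (large B (full B A badA total′ goodA) badB))

-- Parametrisation of `s` and `m`, and assembly of both bounds.

odd⇒suc-double : ∀ {x} → 2 ∤ x → ∃ λ h → x ≡ suc (h + h)
odd⇒suc-double {x} 2∤x with x % 2 in eq | m%n<n x 2 | m≡m%n+[m/n]*n x 2
... | 0           | _ | _ = contradiction (m%n≡0⇒n∣m x 2 eq) 2∤x
... | 1           | _ | e =
  x / 2 , trans e (cong suc (trans (*-comm (x / 2) 2) (cong (x / 2 +_) (+-identityʳ (x / 2)))))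
... | suc (suc _) | s≤s (s≤s ()) | _

[x+x]/2≡x : ∀ x → (x + x) / 2 ≡ x
[x+x]/2≡x x = trans (cong (_/ 2) (trans (cong (x +_) (sym (+-identityʳ x))) (*-comm 2 x))) (m*n/n≡m x 2)

even-case : ∀ s → s ≥ 3 → (∃ λ h → s ≡ suc (h + h)) → ∀ m n → m ≥ 2 → 2 ∣ m →
            n ≥ ((s * m) / 2) * (s * m ∸ 2) → IsRamseyNumber (path n) (jahangir s m) (2 * n ∸ 1)
even-case s s≥3 odd m n m≥2 (divides m′ refl) n-large =
  let b , 3+b≡ = m≤n⇒∃[o]m+o≡n (≤-trans s≥3 (m≤m*n s m′ {{m′≢0}})) in
  reduce b (trans (double s m′) (sym (cong₂ _+_ 3+b≡ 3+b≡))) n n-large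
  where
  m′≢0 : NonZero m′
  m′≢0 = ≢-nonZero λ { refl → contradiction m≥2 λ () }
  double : ∀ s m′ → s * (m′ * 2) ≡ s * m′ + s * m′
  double = solve-∀
  reduce : ∀ b → s * m ≡ (3 + b) + (3 + b) → ∀ n → n ≥ ((s * m) / 2) * (s * m ∸ 2) →
           IsRamseyNumber (path n) (jahangir s m) (2 * n ∸ 1)
  reduce b k≡ n n-large = conclusion n (subst (_≤ n) bound n-large)
    where
    bound : ((s * m) / 2) * (s * m ∸ 2) ≡ (3 + b) * ((2 + b) + (2 + b))
    bound = trans (cong (λ k → (k / 2) * (k ∸ 2)) k≡)
      (cong₂ _*_ ([x+x]/2≡x (3 + b)) (cong (1 +_) (+-suc b (2 + b))))
    instance
      k≢0 : NonZero (s * m)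
      k≢0 = subst NonZero (sym k≡) _
    conclusion : ∀ n → (3 + b) * ((2 + b) + (2 + b)) ≤ n →
             IsRamseyNumber (path n) (jahangir s m) (2 * n ∸ 1)
    conclusion zero          ()
    conclusion (suc zero)    (s≤s ())
    conclusion n@(suc d@(suc _)) n≥ =
        (λ F → UpperBound.upper-even F s m s≥3 n b k≡ n≥ (size d))
      , (λ M ramsey → ≤-trans (≤-reflexive (N≡ d)) (lower-even s m d m≥2 odd M ramsey))
      where
      size : ∀ d → d + suc (d + 0) + 1 ≡ suc d + suc d + 0
      size = solve-∀
      N≡ : ∀ d → d + suc (d + 0) ≡ suc (d + d)
      N≡ = solve-∀

odd-case : ∀ s → s ≥ 3 → (∃ λ h → s ≡ suc (h + h)) → ∀ m n → m ≥ 3 → (∃ λ g → m ≡ suc (g + g)) →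
           n ≥ ((s * m ∸ 1) / 2) * (s * m ∸ 1) → IsRamseyNumber (path n) (jahangir s m) (2 * n)
odd-case _ (s≤s ()) (zero , refl)
odd-case _ _ (suc _ , refl) _ _ (s≤s ()) (zero , refl)
odd-case s s≥3 odd@(h@(suc h′) , refl) m n m≥3 (suc g , refl) n-large =
  conclusion n (subst (_≤ n) bound n-large)
  where
  -- Here `s = 2 * h′ + 3` and `m = 2 * g + 3`, whence `s * m = 2 * b + 9`.
  b = s * g + (h′ + h′ + h′)
  k≡ : s * m ≡ 3 + ((3 + b) + (3 + b))
  k≡ = ident h′ g
    where
    ident : ∀ h′ g → let s = suc (suc h′ + suc h′) ; b = s * g + (h′ + h′ + h′) in
            s * suc (suc g + suc g) ≡ 3 + ((3 + b) + (3 + b))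
    ident = solve-∀
  k≡′ : s * m ≡ suc ((4 + b) + (4 + b))
  k≡′ = trans k≡ (cong (5 +_) (sym (+-suc b (3 + b))))
  bound : ((s * m ∸ 1) / 2) * (s * m ∸ 1) ≡ (4 + b) * ((4 + b) + (4 + b))
  bound = trans (cong (λ k → ((k ∸ 1) / 2) * (k ∸ 1)) k≡′)
    (cong (_* ((4 + b) + (4 + b))) ([x+x]/2≡x (4 + b)))
  arc : ∃ λ l → s + s + suc (l + l) ≡ s * m × s ∣ suc (l + l)
  -- Beyond position `2 * s` the rim has length `s * (m - 2)`, and `m - 2 = 2 * g + 1` is odd.
  arc = s * g + h , ident h g , divides (suc (g + g)) (ident′ h g)
    where
    ident : ∀ h g → let s = suc (h + h) ; l = s * g + h in
            s + s + suc (l + l) ≡ s * suc (suc g + suc g)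
    ident = solve-∀
    ident′ : ∀ h g → let s = suc (h + h) ; l = s * g + h in suc (l + l) ≡ suc (g + g) * s
    ident′ = solve-∀
  conclusion : ∀ n → (4 + b) * ((4 + b) + (4 + b)) ≤ n → IsRamseyNumber (path n) (jahangir s m) (2 * n)
  conclusion zero          ()
  conclusion (suc zero)    (s≤s ())
  -- The cliques of the lower bound have `d = n - 1` vertices, a positive number by the bound on
  -- `n`.
  conclusion n@(suc d@(suc _)) n≥ =
      (λ F → UpperBound.upper-odd F s m s≥3 n b k≡ n≥ (size n))
    , (λ M ramsey → ≤-trans (≤-reflexive (N≡ d))
        (lower-odd s m d m≥3 odd arc (4 + b , k≡′) M ramsey))
    where
    size : ∀ n → 2 * n + 1 ≡ n + n + 1
    size = solve-∀
    N≡ : ∀ d → 2 * suc d ≡ suc (suc (d + d))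
    N≡ = solve-∀

theorem2 : (s : ℕ) → s ≥ 3 → 2 ∤ s →
    ((m n : ℕ) → m ≥ 2 → 2 ∣ m → n ≥ ((s * m) / 2) * (s * m ∸ 2) →
      IsRamseyNumber (path n) (jahangir s m) (2 * n ∸ 1))
    ×
    ((m n : ℕ) → m ≥ 3 → 2 ∤ m → n ≥ ((s * m ∸ 1) / 2) * (s * m ∸ 1) →
      IsRamseyNumber (path n) (jahangir s m) (2 * n))
theorem2 s s≥3 2∤s =
    even-case s s≥3 (odd⇒suc-double 2∤s)
  , λ m n m≥3 2∤m → odd-case s s≥3 (odd⇒suc-double 2∤s) m n m≥3 (odd⇒suc-double 2∤m)
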